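{- For every integer $s\ge 4$ there is a constant $c=c(s)>0$ such that for all integers $n\ge1$, $$f_{s,s+2}(n)\le c\sqrt{n}.$$
   Context: For integers $2\le s<t$ and $n\ge1$, $f_{s,t}(n)$ denotes the minimum, over all $K_t$-free graphs $G$ on $n$ vertices, of the maximum size of a set $W\subseteq V(G)$ such that the induced subgraph $G[W]$ contains no copy of $K_s$. -}

module Defs where

open import Data.Nat using (ℕ)
open import Data.Bool using (Bool; true; false)
open import Data.Fin using (Fin)
open import Data.Fin.Subset using (Subset; _∈_)
open import Data.Product using (Σ; _×_)
open import Relation.Binary.PropositionalEquality using (_≡_; _≢_)
open import Relation.Nullary using (¬_)

record Graph (n : ℕ) : Set where
  field
    adj   : Fin n → Fin n → Bool
    sym   : ∀ u v → adj u v ≡ adj v u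
    irrefl : ∀ v → adj v v ≡ false

open Graph public

CliqueIn : ∀ {n} → Graph n → (k : ℕ) → Subset n → Set
CliqueIn {n} G k W =
  Σ (Fin k → Fin n) λ f →
    (∀ i → f i ∈ W) ×
    (∀ i j → i ≢ j → (f i ≢ f j) × (adj G (f i) (f j) ≡ true))

KFree : ∀ {n} → Graph n → ℕ → Set
KFree {n} G k = ∀ (W : Subset n) → ¬ CliqueIn G k W

KFreeOn : ∀ {n} → Graph n → ℕ → Subset n → Set
KFreeOn G k W = ¬ CliqueIn G k W

{-# OPTIONS --safe #-}
-- On the affine plane of prime order q select every line independently with probability about
-- log q / q, colour its points at random with s colours, and join two points when they have
-- different colours on a selected line. A set W of C q points meets at least half of the lines in
-- at least s points (second moments), and each such line, if selected, contains a rainbow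
-- s-subset of W with probability at least s ^ -s, so W is K_s-free with probability at most
-- q ^ -(2 C q + 2), and a union bound over all W applies. In a clique of s + 2 points every line has at
-- most s of them, so four of the points form a quadrangle; two further points then force one of
-- three configurations with r + 1 degrees of freedom and r distinct selected lines (r = 9, 8, 7).
-- Only q polylog q of these are expected, and deleting a point from each leaves a K_{s+2}-free
-- graph on at least q² / 2 points. The weighted count of bad events is a sum of products over
-- the lines, so a good outcome is found by conditional expectations. Chebyshev's argument
-- provides a suitable prime q within a constant factor of √n.
module Submission where

open import Defs hiding (sym)
open import Data.Bool.Base using (Bool; true; false)
import Data.Bool.Properties as Boolₚ
open import Data.Fin as Fin using (Fin; zero; suc; toℕ)
import Data.Fin.Properties as Finₚ
open import Data.Fin.Subset as Subset using (Subset; ∣_∣)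
open import Data.List.Base as List using (List; []; _∷_; _++_; length; map; filter; replicate; take; allFin; cartesianProductWith; cartesianProduct)
import Data.List.Properties as Listₚ
import Data.List.Membership.DecPropositional as DecMembership
open import Data.List.Membership.Propositional using (_∈_; _∉_)
import Data.List.Membership.Propositional.Properties as ∈ₚ
open import Data.List.Relation.Unary.All as All using (All; []; _∷_)
open import Data.List.Relation.Unary.AllPairs using ([]; _∷_)
open import Data.List.Relation.Unary.Any as Any using (Any; here; there)
import Data.List.Relation.Unary.Any.Properties as Anyₚ
open import Data.List.Relation.Unary.Unique.DecPropositional using (unique?)
open import Data.List.Relation.Unary.Unique.Propositional using (Unique)
import Data.List.Relation.Unary.Unique.Propositional.Properties as Uniqueₚ
open import Data.Nat
open import Data.Nat.Coprimality using (Coprime; coprime-divisor)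
open import Data.Nat.Divisibility
open import Data.Nat.DivMod
open import Data.Nat.Induction using (<-rec)
open import Data.Nat.ListAction using (product)
open import Data.Nat.Primality
open import Data.Nat.Primality.Factorisation using (factorise; PrimeFactorisation)
open import Data.Nat.Properties
open import Data.Nat.Tactic.RingSolver using (solve-∀)
open import Data.Product using (Σ; ∃; _×_; _,_; proj₁; proj₂)
open import Data.Product.Properties using (≡-dec)
open import Data.Sum using (_⊎_; inj₁; inj₂)
open import Data.Unit using (tt)
open import Data.Vec.Base as Vec using (Vec; []; _∷_)
import Data.Vec.Properties as Vecₚ
open import Function using (_∘_; id; case_of_)
open import Relation.Binary.Definitions using (DecidableEquality)
open import Relation.Binary.PropositionalEquality hiding ([_]; J)
open import Relation.Nullary using (¬_; Dec; yes; no; does; contradiction)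
open import Relation.Nullary.Decidable using (_×-dec_; ¬?; dec-true; dec-false)

-- A configuration can be afforded when its degrees of freedom exceed its number r of lines by at
-- most one: q^(r+1) placements, each selected with probability (b/q)^r, amount to q b^r, far below
-- q². Near-pencils (s points on a line and one outside) violate this, with expectation about q³ up
-- to logarithms. They are cliques on only s + 1 points; among s + 2 points at least two lie off
-- every line. A bare quadrangle also violates it: eight degrees of freedom and six lines leave
-- about q² b^6 copies. A fifth point at the intersection of two opposite sides adds neither a
-- degree of freedom nor a line, so five points can be too few. A second such point contributes the
-- line joining both. This is why six clique points, hence s ≥ 4, are required. One parallel class
-- of the plane is dropped so that a single coordinate labels the points of every line. A colouring
-- of a line is then a vector of length q, and all lines share one space of choices; points with
-- equal coordinate are never joined. Probabilities appear as counts with cleared denominators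
-- throughout.

private variable
  A A′ A″ : Set

-- Finite sums and products

∑ : List A → (A → ℕ) → ℕ
∑ []       f = 0
∑ (x ∷ xs) f = f x + ∑ xs f

∏ : List A → (A → ℕ) → ℕ
∏ []       f = 1
∏ (x ∷ xs) f = f x * ∏ xs f

∑-mono : ∀ (xs : List A) {f g} → (∀ x → f x ≤ g x) → ∑ xs f ≤ ∑ xs g
∑-mono []       h = ≤-refl
∑-mono (x ∷ xs) h = +-mono-≤ (h x) (∑-mono xs h)

∑-cong : ∀ (xs : List A) {f g} → (∀ x → f x ≡ g x) → ∑ xs f ≡ ∑ xs g
∑-cong []       h = refl
∑-cong (x ∷ xs) h = cong₂ _+_ (h x) (∑-cong xs h)

∏-mono : ∀ (xs : List A) {f g} → (∀ x → f x ≤ g x) → ∏ xs f ≤ ∏ xs g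
∏-mono []       h = ≤-refl
∏-mono (x ∷ xs) h = *-mono-≤ (h x) (∏-mono xs h)

∏-cong∈ : ∀ (xs : List A) {f g} → (∀ x → x ∈ xs → f x ≡ g x) → ∏ xs f ≡ ∏ xs g
∏-cong∈ []       h = refl
∏-cong∈ (x ∷ xs) h = cong₂ _*_ (h x (here refl)) (∏-cong∈ xs λ y → h y ∘ there)

∏-cong : ∀ (xs : List A) {f g} → (∀ x → f x ≡ g x) → ∏ xs f ≡ ∏ xs g
∏-cong xs h = ∏-cong∈ xs λ x _ → h x

∑-const : ∀ (xs : List A) c → ∑ xs (λ _ → c) ≡ length xs * c
∑-const []       c = refl
∑-const (x ∷ xs) c = cong (c +_) (∑-const xs c)

∏-const : ∀ (xs : List A) c → ∏ xs (λ _ → c) ≡ c ^ length xs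
∏-const []       c = refl
∏-const (x ∷ xs) c = cong (c *_) (∏-const xs c)

∑-+ : ∀ (xs : List A) f g → ∑ xs (λ x → f x + g x) ≡ ∑ xs f + ∑ xs g
∑-+ []       f g = refl
∑-+ (x ∷ xs) f g = trans (cong (f x + g x +_) (∑-+ xs f g)) (lemma (f x) (g x) (∑ xs f) (∑ xs g))
  where
  lemma : ∀ a b c d → a + b + (c + d) ≡ a + c + (b + d)
  lemma = solve-∀

∏-* : ∀ (xs : List A) f g → ∏ xs (λ x → f x * g x) ≡ ∏ xs f * ∏ xs g
∏-* []       f g = refl
∏-* (x ∷ xs) f g = trans (cong (f x * g x *_) (∏-* xs f g)) (lemma (f x) (g x) (∏ xs f) (∏ xs g))
  where
  lemma : ∀ a b c d → a * b * (c * d) ≡ a * c * (b * d)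
  lemma = solve-∀

∑-*ˡ : ∀ (xs : List A) c f → ∑ xs (λ x → c * f x) ≡ c * ∑ xs f
∑-*ˡ []       c f = sym (*-zeroʳ c)
∑-*ˡ (x ∷ xs) c f = trans (cong (c * f x +_) (∑-*ˡ xs c f)) (sym (*-distribˡ-+ c (f x) (∑ xs f)))

∑-*ʳ : ∀ (xs : List A) c f → ∑ xs (λ x → f x * c) ≡ ∑ xs f * c
∑-*ʳ xs c f = trans (∑-cong xs λ x → *-comm (f x) c) (trans (∑-*ˡ xs c f) (*-comm c (∑ xs f)))

∏-^ : ∀ (xs : List A) c f → ∏ xs (λ x → c ^ f x) ≡ c ^ ∑ xs f
∏-^ []       c f = refl
∏-^ (x ∷ xs) c f = trans (cong (c ^ f x *_) (∏-^ xs c f)) (sym (^-distribˡ-+-* c (f x) (∑ xs f)))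

∑-zero : ∀ (xs : List A) → ∑ xs (λ _ → 0) ≡ 0
∑-zero []       = refl
∑-zero (x ∷ xs) = ∑-zero xs

∑-swap : ∀ (xs : List A) (ys : List A′) (f : A → A′ → ℕ) →
         ∑ xs (λ x → ∑ ys (f x)) ≡ ∑ ys (λ y → ∑ xs (λ x → f x y))
∑-swap []       ys f = sym (∑-zero ys)
∑-swap (x ∷ xs) ys f = trans (cong (∑ ys (f x) +_) (∑-swap xs ys f)) (sym (∑-+ ys (f x) _))

∏-swap : ∀ (xs : List A) (ys : List A′) (f : A → A′ → ℕ) →
         ∏ xs (λ x → ∏ ys (f x)) ≡ ∏ ys (λ y → ∏ xs (λ x → f x y))
∏-swap []       ys f = sym (trans (∏-const ys 1) (^-zeroˡ (length ys)))
∏-swap (x ∷ xs) ys f = trans (cong (∏ ys (f x) *_) (∏-swap xs ys f)) (sym (∏-* ys (f x) _))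

∑-++ : ∀ (xs ys : List A) f → ∑ (xs ++ ys) f ≡ ∑ xs f + ∑ ys f
∑-++ []       ys f = refl
∑-++ (x ∷ xs) ys f = trans (cong (f x +_) (∑-++ xs ys f)) (sym (+-assoc (f x) _ _))

∑-map : ∀ (xs : List A) (h : A → A′) f → ∑ (map h xs) f ≡ ∑ xs (f ∘ h)
∑-map []       h f = refl
∑-map (x ∷ xs) h f = cong (f (h x) +_) (∑-map xs h f)

∏-map : ∀ (xs : List A) (h : A → A′) f → ∏ (map h xs) f ≡ ∏ xs (f ∘ h)
∏-map []       h f = refl
∏-map (x ∷ xs) h f = cong (f (h x) *_) (∏-map xs h f)

∑-× : ∀ (h : A → A′ → A″) xs ys f →
      ∑ (cartesianProductWith h xs ys) f ≡ ∑ xs (λ x → ∑ ys (λ y → f (h x y)))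
∑-× h []       ys f = refl
∑-× h (x ∷ xs) ys f = trans (∑-++ (map (h x) ys) _ f)
  (cong₂ _+_ (∑-map ys (h x) f) (∑-× h xs ys f))

length-× : ∀ (h : A → A′ → A″) xs ys → length (cartesianProductWith h xs ys) ≡ length xs * length ys
length-× h []       ys = refl
length-× h (x ∷ xs) ys = trans (Listₚ.length-++ (map (h x) ys))
  (cong₂ _+_ (Listₚ.length-map (h x) ys) (length-× h xs ys))

∑-term : ∀ (xs : List A) f {x} → x ∈ xs → f x ≤ ∑ xs f
∑-term (x ∷ xs) f (here refl) = m≤m+n _ _
∑-term (y ∷ xs) f (there x∈)  = ≤-trans (∑-term xs f x∈) (m≤n+m _ (f y))

∏≤1 : ∀ (xs : List A) {f} → (∀ x → f x ≤ 1) → ∏ xs f ≤ 1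
∏≤1 xs h = subst (∏ xs _ ≤_) (trans (∏-const xs 1) (^-zeroˡ (length xs))) (∏-mono xs h)

∏-zero : ∀ (xs : List A) {f x} → x ∈ xs → f x ≡ 0 → ∏ xs f ≡ 0
∏-zero (x ∷ xs) (here refl) e rewrite e = refl
∏-zero (y ∷ xs) {f} (there x∈) e rewrite ∏-zero xs {f} x∈ e = *-zeroʳ (f y)

∏≡0 : ∀ (xs : List A) f → ∏ xs f ≡ 0 → ∃ λ x → x ∈ xs × f x ≡ 0
∏≡0 (x ∷ xs) f e with m*n≡0⇒m≡0∨n≡0 (f x) e
... | inj₁ e′ = x , here refl , e′
... | inj₂ e′ = let y , y∈ , e″ = ∏≡0 xs f e′ in y , there y∈ , e″

∏≡1 : ∀ (xs : List A) f → ∏ xs f ≡ 1 → ∀ {x} → x ∈ xs → f x ≡ 1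
∏≡1 (x ∷ xs) f e (here refl) = m*n≡1⇒m≡1 (f x) _ e
∏≡1 (x ∷ xs) f e (there x∈)  = ∏≡1 xs f (m*n≡1⇒n≡1 (f x) _ e) x∈

∏-one : ∀ (xs : List A) {f} → (∀ x → x ∈ xs → f x ≡ 1) → ∏ xs f ≡ 1
∏-one []       h = refl
∏-one (x ∷ xs) h rewrite h x (here refl) = trans (+-identityʳ _) (∏-one xs λ y → h y ∘ there)

∏-term : ∀ (xs : List A) {f} → (∀ x → 1 ≤ f x) → ∀ {x} → x ∈ xs → f x ≤ ∏ xs f
∏-term (x ∷ xs) {f} h (here refl) = begin
  f x            ≡⟨ *-identityʳ (f x) ⟨
  f x * 1        ≡⟨ cong (f x *_) (^-zeroˡ (length xs)) ⟨
  f x * 1 ^ length xs ≡⟨ cong (f x *_) (∏-const xs 1) ⟨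
  f x * ∏ xs (λ _ → 1) ≤⟨ *-monoʳ-≤ (f x) (∏-mono xs h) ⟩
  f x * ∏ xs f   ∎
  where open ≤-Reasoning
∏-term (y ∷ xs) {f} h {x} (there x∈) = begin
  f x            ≤⟨ ∏-term xs h x∈ ⟩
  ∏ xs f         ≡⟨ *-identityˡ _ ⟨
  1 * ∏ xs f     ≤⟨ *-monoˡ-≤ (∏ xs f) (h y) ⟩
  f y * ∏ xs f   ∎
  where open ≤-Reasoning

-- Indicators and replacement of a single factor

[_] : Dec A → ℕ
[ yes _ ] = 1
[ no _ ]  = 0

[]≤1 : (d : Dec A) → [ d ] ≤ 1
[]≤1 (yes _) = ≤-refl
[]≤1 (no _)  = z≤n

[]-yes : (d : Dec A) → A → [ d ] ≡ 1
[]-yes (yes _) a = refl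
[]-yes (no ¬a) a = contradiction a ¬a

[]-no : (d : Dec A) → ¬ A → [ d ] ≡ 0
[]-no (yes a) ¬a = contradiction a ¬a
[]-no (no _)  ¬a = refl

[]≡1 : (d : Dec A) → [ d ] ≡ 1 → A
[]≡1 (yes a) _ = a

∑-none : ∀ (xs : List A) {P : A → Set} (P? : ∀ x → Dec (P x)) →
         (∀ {x} → x ∈ xs → ¬ P x) → ∑ xs (λ x → [ P? x ]) ≡ 0
∑-none []       P? h = refl
∑-none (x ∷ xs) P? h rewrite []-no (P? x) (h (here refl)) = ∑-none xs P? (h ∘ there)

∑-atMostOne : ∀ (xs : List A) {P : A → Set} (P? : ∀ x → Dec (P x)) → Unique xs →
              (∀ {x y} → P x → P y → x ≡ y) → ∑ xs (λ x → [ P? x ]) ≤ 1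
∑-atMostOne []       P? u h = z≤n
∑-atMostOne (x ∷ xs) P? (x∉ ∷ u) h with P? x
... | no _  = ∑-atMostOne xs P? u h
... | yes p = ≤-reflexive (cong suc (∑-none xs P? λ y∈ q → All.lookup x∉ y∈ (h p q)))

∑-exactlyOne : ∀ (xs : List A) {P : A → Set} (P? : ∀ x → Dec (P x)) → Unique xs →
               (∀ {x y} → P x → P y → x ≡ y) → ∀ {x} → x ∈ xs → P x → ∑ xs (λ x → [ P? x ]) ≡ 1
∑-exactlyOne xs P? u h {x} x∈ p = ≤-antisym (∑-atMostOne xs P? u h)
  (subst (_≤ ∑ xs (λ y → [ P? y ])) ([]-yes (P? x) p) (∑-term xs (λ y → [ P? y ]) x∈))

if-dec : Dec A → ℕ → ℕ → ℕ
if-dec (yes _) a b = a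
if-dec (no _)  a b = b

if-yes : (d : Dec A) → A → ∀ {x y} → if-dec d x y ≡ x
if-yes (yes _) a = refl
if-yes (no ¬a) a = contradiction a ¬a

if-no : (d : Dec A) → ¬ A → ∀ {x y} → if-dec d x y ≡ y
if-no (yes a) ¬a = contradiction a ¬a
if-no (no _)  ¬a = refl

module _ (_≟A_ : DecidableEquality A) where

  -- Replacing the factor at `a` by `α` would mean dividing by `g a`; the cross-multiplied form
  -- stays in ℕ and allows `g a` to vanish.
  ∏-exchange : ∀ (xs : List A) → Unique xs → ∀ {a} → a ∈ xs → ∀ α (g : A → ℕ) →
               ∏ xs (λ x → if-dec (x ≟A a) α (g x)) * g a ≡ ∏ xs g * α
  ∏-exchange (x ∷ xs) (x∉ ∷ u) (here refl) α g = begin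
    if-dec (x ≟A x) α (g x) * P * g x ≡⟨ cong (λ z → z * P * g x) (if-yes (x ≟A x) refl) ⟩
    α * P * g x     ≡⟨ cong (λ z → α * z * g x) (∏-cong∈ xs λ y y∈ → if-no (y ≟A x) λ e → All.lookup x∉ y∈ (sym e)) ⟩
    α * ∏ xs g * g x ≡⟨ lemma α (∏ xs g) (g x) ⟩
    g x * ∏ xs g * α ∎
    where
    open ≡-Reasoning
    P = ∏ xs (λ y → if-dec (y ≟A x) α (g y))
    lemma : ∀ a b c → a * b * c ≡ c * b * a
    lemma = solve-∀
  ∏-exchange (x ∷ xs) (x∉ ∷ u) {a} (there a∈) α g = begin
    if-dec (x ≟A a) α (g x) * P * g a ≡⟨ cong (λ z → z * P * g a) (if-no (x ≟A a) λ e → All.lookup x∉ a∈ e) ⟩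
    g x * P * g a   ≡⟨ *-assoc (g x) P (g a) ⟩
    g x * (P * g a) ≡⟨ cong (g x *_) (∏-exchange xs u a∈ α g) ⟩
    g x * (∏ xs g * α) ≡⟨ *-assoc (g x) (∏ xs g) α ⟨
    g x * ∏ xs g * α ∎
    where
    open ≡-Reasoning
    P = ∏ xs (λ y → if-dec (y ≟A a) α (g y))

-- The minimum is at most the mean.
∑-pigeonhole : ∀ (ds : List A) → 1 ≤ length ds → (F : A → ℕ) → ∃ λ d → length ds * F d ≤ ∑ ds F
∑-pigeonhole (x ∷ []) _ F = x , ≤-refl
∑-pigeonhole (x ∷ ds@(_ ∷ _)) _ F with ∑-pigeonhole ds (s≤s z≤n) F
... | d , h with ≤-total (F x) (F d)
...   | inj₁ le = x , +-monoʳ-≤ (F x) (≤-trans (*-monoʳ-≤ (length ds) le) h)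
...   | inj₂ le = d , +-mono-≤ le h

update : DecidableEquality A → A → A′ → (A → A′) → A → A′
update _≟A_ a b f x with x ≟A a
... | yes _ = b
... | no _  = f x

update-≡ : ∀ (_≟A_ : DecidableEquality A) a (b : A′) f → update _≟A_ a b f a ≡ b
update-≡ _≟A_ a b f with a ≟A a
... | yes _ = refl
... | no ¬e = contradiction refl ¬e

update-≢ : ∀ (_≟A_ : DecidableEquality A) {a} (b : A′) f {x} → x ≢ a → update _≟A_ a b f x ≡ f x
update-≢ _≟A_ {a} b f {x} ne with x ≟A a
... | yes e = contradiction e ne
... | no _  = refl

-- Method of conditional expectations: independent uniform choices from ds, one for each
-- element of xs, and a weighted sum of costs that factor over xs.
average : ∀ {A D J : Set} (_≟A_ : DecidableEquality A) (xs : List A) → Unique xs →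
          (ds : List D) → 1 ≤ length ds →
          (js : List J) (c : J → ℕ) (w : J → A → D → ℕ) →
          ∃ λ (ω : A → D) →
            ∑ js (λ j → c j * ∏ xs (λ x → w j x (ω x))) * length ds ^ length xs
              ≤ ∑ js (λ j → c j * ∏ xs (λ x → ∑ ds (w j x)))
average _≟A_ [] u (d ∷ ds) _ js c w = (λ _ → d) , ≤-reflexive (*-identityʳ _)
average {D = D} _≟A_ (x ∷ xs) (x∉ ∷ u) ds ne js c w = ω , bound
  where
  S = λ j → ∏ xs (λ y → ∑ ds (w j y))
  F : D → ℕ
  F d = ∑ js (λ j → c j * w j x d * S j)
  pig = ∑-pigeonhole ds ne F
  d = proj₁ pig
  -- The cost already incurred at `x` becomes part of the constants, which is why the statement
  -- carries arbitrary `c`.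
  rec = average _≟A_ xs u ds ne js (λ j → c j * w j x d) w
  ω′ = proj₁ rec
  ω = update _≟A_ x d ω′
  R = length ds ^ length xs
  lemma : ∀ a b c d → a * b * (c * d) ≡ c * (a * b * d)
  lemma = solve-∀
  same : ∀ j → c j * ∏ (x ∷ xs) (λ y → w j y (ω y)) ≡ c j * w j x d * ∏ xs (λ y → w j y (ω′ y))
  same j = trans (sym (*-assoc (c j) _ _)) (cong₂ _*_ (cong (λ z → c j * w j x z) (update-≡ _≟A_ x d ω′))
    (∏-cong∈ xs λ y y∈ → cong (w j y) (update-≢ _≟A_ d ω′ λ e → All.lookup x∉ y∈ (sym e))))
  swapF : ∑ ds F ≡ ∑ js (λ j → c j * ∏ (x ∷ xs) (λ y → ∑ ds (w j y)))
  swapF = trans (∑-swap ds js _) (∑-cong js λ j → trans (∑-cong ds λ d → lemma₂ (c j) (w j x d) (S j))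
    (trans (∑-*ʳ ds (c j * S j) (w j x)) (lemma₃ (∑ ds (w j x)) (c j) (S j))))
    where
    lemma₂ : ∀ a b c → a * b * c ≡ b * (a * c)
    lemma₂ = solve-∀
    lemma₃ : ∀ a b c → a * (b * c) ≡ b * (a * c)
    lemma₃ = solve-∀
  bound : ∑ js (λ j → c j * ∏ (x ∷ xs) (λ y → w j y (ω y))) * (length ds * R)
            ≤ ∑ js (λ j → c j * ∏ (x ∷ xs) (λ y → ∑ ds (w j y)))
  bound = begin
    ∑ js (λ j → c j * ∏ (x ∷ xs) (λ y → w j y (ω y))) * (length ds * R)
      ≡⟨ cong (_* (length ds * R)) (∑-cong js same) ⟩
    T * (length ds * R)   ≡⟨ lemma₄ T (length ds) R ⟩
    length ds * (T * R)   ≤⟨ *-monoʳ-≤ (length ds) (proj₂ rec) ⟩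
    length ds * F d       ≤⟨ proj₂ pig ⟩
    ∑ ds F                ≡⟨ swapF ⟩
    _ ∎
    where
    open ≤-Reasoning
    T = ∑ js (λ j → c j * w j x d * ∏ xs (λ y → w j y (ω′ y)))
    lemma₄ : ∀ a b c → a * (b * c) ≡ b * (a * c)
    lemma₄ = solve-∀

-- Spaces of vectors

allVecs : List A → ∀ k → List (Vec A k)
allVecs xs zero    = [] ∷ []
allVecs xs (suc k) = cartesianProductWith _∷_ xs (allVecs xs k)

length-allVecs : ∀ (xs : List A) k → length (allVecs xs k) ≡ length xs ^ k
length-allVecs xs zero    = refl
length-allVecs xs (suc k) = trans (length-× _∷_ xs (allVecs xs k)) (cong (length xs *_) (length-allVecs xs k))

∈-allVecs : ∀ {xs : List A} → (∀ x → x ∈ xs) → ∀ {k} (v : Vec A k) → v ∈ allVecs xs k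
∈-allVecs h []      = here refl
∈-allVecs h (x ∷ v) = ∈ₚ.∈-cartesianProductWith⁺ _∷_ (h x) (∈-allVecs h v)

∏-allFin-suc : ∀ n (f : Fin (suc n) → ℕ) → ∏ (allFin (suc n)) f ≡ f zero * ∏ (allFin n) (f ∘ suc)
∏-allFin-suc n f = cong (f zero *_) (trans (cong (λ xs → ∏ xs f) (sym (Listₚ.map-tabulate id suc)))
  (∏-map (allFin n) suc f))

-- Independence of the coordinates of a uniform vector: a product of functions of single coordinates
-- has the product of their sums as its sum.
∑-allVecs-∏ : ∀ (xs : List A) q (g : Fin q → A → ℕ) →
  ∑ (allVecs xs q) (λ v → ∏ (allFin q) (λ i → g i (Vec.lookup v i))) ≡ ∏ (allFin q) (λ i → ∑ xs (g i))
∑-allVecs-∏ xs zero    g = refl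
∑-allVecs-∏ xs (suc q) g = begin
  ∑ (allVecs xs (suc q)) (λ v → ∏ (allFin (suc q)) (λ i → g i (Vec.lookup v i)))
    ≡⟨ ∑-× _∷_ xs (allVecs xs q) _ ⟩
  ∑ xs (λ x → ∑ (allVecs xs q) (λ v → ∏ (allFin (suc q)) (λ i → g i (Vec.lookup (x ∷ v) i))))
    ≡⟨ ∑-cong xs (λ x → trans (∑-cong (allVecs xs q) λ v → ∏-allFin-suc q (λ i → g i (Vec.lookup (x ∷ v) i)))
         (trans (∑-*ˡ (allVecs xs q) (g zero x) _) (cong (g zero x *_) (∑-allVecs-∏ xs q (g ∘ suc))))) ⟩
  ∑ xs (λ x → g zero x * ∏ (allFin q) (λ i → ∑ xs (g (suc i))))
    ≡⟨ ∑-*ʳ xs _ (g zero) ⟩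
  ∑ xs (g zero) * ∏ (allFin q) (λ i → ∑ xs (g (suc i)))
    ≡⟨ ∏-allFin-suc q (λ i → ∑ xs (g i)) ⟨
  ∏ (allFin (suc q)) (λ i → ∑ xs (g i)) ∎
  where open ≡-Reasoning

-- Primes between 4 ^ m / 8 and 4 ^ m

binom : ℕ → ℕ → ℕ
binom n       zero    = 1
binom zero    (suc k) = 0
binom (suc n) (suc k) = binom n k + binom n (suc k)

binom-absorb : ∀ n k → suc k * binom (suc n) (suc k) ≡ suc n * binom n k
binom-absorb zero    zero    = refl
binom-absorb zero    (suc k) = *-zeroʳ (suc (suc k))
binom-absorb (suc n) zero    = begin
  1 * (1 + binom (suc n) 1)     ≡⟨ *-distribˡ-+ 1 1 (binom (suc n) 1) ⟩
  1 + 1 * binom (suc n) 1       ≡⟨ cong suc (binom-absorb n 0) ⟩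
  1 + suc n * 1                 ∎
  where open ≡-Reasoning
binom-absorb (suc n) (suc k) = begin
  suc (suc k) * (x + y)                ≡⟨ lemma₁ (suc k) x y ⟩
  x + (suc k * x + suc (suc k) * y)    ≡⟨ cong (x +_) (cong₂ _+_ (binom-absorb n k) (binom-absorb n (suc k))) ⟩
  x + (suc n * binom n k + suc n * binom n (suc k)) ≡⟨ cong (x +_) (*-distribˡ-+ (suc n) (binom n k) _) ⟨
  suc (suc n) * x                      ∎
  where
  open ≡-Reasoning
  x = binom (suc n) (suc k)
  y = binom (suc n) (suc (suc k))
  lemma₁ : ∀ k x y → suc k * (x + y) ≡ x + (k * x + suc k * y)
  lemma₁ = solve-∀

binom-pos : ∀ {n k} → k ≤ n → 0 < binom n k
binom-pos {n} {zero}  _ = s≤s z≤n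
binom-pos {suc n} {suc k} (s≤s k≤n) = <-≤-trans (binom-pos k≤n) (m≤m+n _ _)

binom-zero : ∀ {n k} → n < k → binom n k ≡ 0
binom-zero {zero}  {suc k} _ = refl
binom-zero {suc n} {suc k} (s≤s n<k) = cong₂ _+_ (binom-zero n<k) (binom-zero (m≤n⇒m≤1+n n<k))

binom≤2^ : ∀ n k → binom n k ≤ 2 ^ n
binom≤2^ n zero = m^n>0 2 n
binom≤2^ zero (suc k) = z≤n
binom≤2^ (suc n) (suc k) = +-mono-≤ (binom≤2^ n k) (≤-trans (binom≤2^ n (suc k)) (m≤m+n _ 0))

binom-! : ∀ n k → binom (n + k) k * (n ! * k !) ≡ (n + k) !
binom-! n zero rewrite +-identityʳ n = trans (+-identityʳ _) (*-identityʳ (n !))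
binom-! n (suc k) rewrite +-suc n k = begin
  b * (n ! * (suc k * k !))      ≡⟨ lemma b (n !) (suc k) (k !) ⟩
  (suc k * b) * (n ! * k !)      ≡⟨ cong (_* (n ! * k !)) (binom-absorb (n + k) k) ⟩
  suc (n + k) * binom (n + k) k * (n ! * k !) ≡⟨ *-assoc (suc (n + k)) (binom (n + k) k) (n ! * k !) ⟩
  suc (n + k) * (binom (n + k) k * (n ! * k !)) ≡⟨ cong (suc (n + k) *_) (binom-! n k) ⟩
  suc (n + k) * (n + k) ! ∎
  where
  open ≡-Reasoning
  b = binom (suc (n + k)) (suc k)
  lemma : ∀ b n s k → b * (n * (s * k)) ≡ s * b * (n * k)
  lemma = solve-∀

rowSum : ℕ → ℕ → ℕ
rowSum n zero    = binom n 0
rowSum n (suc m) = rowSum n m + binom n (suc m)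

rowSum-Pascal : ∀ n m → rowSum (suc n) (suc m) ≡ rowSum n m + rowSum n (suc m)
rowSum-Pascal n zero    = refl
rowSum-Pascal n (suc m) rewrite rowSum-Pascal n m = lemma (rowSum n m) _ _ _
  where
  lemma : ∀ a b c d → a + b + (c + d) ≡ a + c + (b + d)
  lemma = solve-∀

rowSum-full : ∀ n → rowSum n n ≡ 2 ^ n
rowSum-full zero    = refl
rowSum-full (suc n) = begin
  rowSum (suc n) (suc n)                    ≡⟨ rowSum-Pascal n n ⟩
  rowSum n n + (rowSum n n + binom n (suc n)) ≡⟨ cong (λ z → rowSum n n + (rowSum n n + z)) (binom-zero (n<1+n n)) ⟩
  2 * rowSum n n                            ≡⟨ cong (2 *_) (rowSum-full n) ⟩
  2 ^ suc n                                 ∎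
  where open ≡-Reasoning

-- Leibniz's harmonic triangle: the reciprocals of z, u, v satisfy 1/z = 1/u + 1/v.
harmonic-∣ : ∀ {z u v D} .{{_ : NonZero z}} .{{_ : NonZero u}} →
             u * v ≡ z * (u + v) → z ∣ D → u ∣ D → v ∣ D
harmonic-∣ {z} {u} {v} {D} h (divides γ D≡γz) (divides α D≡αu) =
  ∣m+n∣m⇒∣n (subst (v ∣_) key (m∣m*n γ)) (m∣m*n α)
  where
  open ≡-Reasoning
  lemma₁ : ∀ v γ z u → v * γ * (z * u) ≡ (γ * z) * (u * v)
  lemma₁ = solve-∀
  lemma₂ : ∀ d z u v → d * (z * (u + v)) ≡ d * (z * u) + z * v * d
  lemma₂ = solve-∀
  lemma₃ : ∀ d z u v α → d * (z * u) + z * v * (α * u) ≡ (v * α + d) * (z * u)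
  lemma₃ = solve-∀
  key : v * γ ≡ v * α + D
  key = *-cancelʳ-≡ (v * γ) (v * α + D) (z * u) {{m*n≢0 z u}} (begin
    v * γ * (z * u)              ≡⟨ lemma₁ v γ z u ⟩
    (γ * z) * (u * v)            ≡⟨ cong₂ _*_ (sym D≡γz) h ⟩
    D * (z * (u + v))            ≡⟨ lemma₂ D z u v ⟩
    D * (z * u) + z * v * D      ≡⟨ cong (λ d → D * (z * u) + z * v * d) D≡αu ⟩
    D * (z * u) + z * v * (α * u) ≡⟨ lemma₃ D z u v α ⟩
    (v * α + D) * (z * u)        ∎)

-- The numbers `suc n * binom n k` are the denominators of Leibniz's triangle. The reciprocal of an
-- entry is the difference of those of the entry above and the left neighbour, so `harmonic-∣`
-- carries divisibility along each row from its first entry `suc n`.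
row-∣ : ∀ {D} n → (∀ j → 1 ≤ j → j ≤ suc n → j ∣ D) → ∀ k → k ≤ n → suc n * binom n k ∣ D
row-∣ {D} n h zero _ = subst (_∣ D) (sym (*-identityʳ (suc n))) (h (suc n) (s≤s z≤n) ≤-refl)
row-∣ {D} (suc n) h (suc k) (s≤s k≤n) =
  harmonic-∣ {{m*n≢0 (suc n) (binom n k) {{_}} {{>-nonZero (binom-pos k≤n)}}}}
             {{m*n≢0 p x {{_}} {{>-nonZero (binom-pos (m≤n⇒m≤1+n k≤n))}}}} identity
    (row-∣ n (λ j 1≤j j≤ → h j 1≤j (m≤n⇒m≤1+n j≤)) k k≤n)
    (row-∣ (suc n) h k (m≤n⇒m≤1+n k≤n))
  where
  open ≡-Reasoning
  p = suc (suc n)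
  x = binom (suc n) k
  y = binom (suc n) (suc k)
  lemma₁ : ∀ k x y p → k * (x + y) * (p * y) ≡ k * y * (p * x + p * y)
  lemma₁ = solve-∀
  identity : p * x * (p * y) ≡ suc n * binom n k * (p * x + p * y)
  identity = begin
    p * x * (p * y)                 ≡⟨ cong (_* (p * y)) (binom-absorb (suc n) k) ⟨
    suc k * (x + y) * (p * y)       ≡⟨ lemma₁ (suc k) x y p ⟩
    suc k * y * (p * x + p * y)     ≡⟨ cong (_* (p * x + p * y)) (binom-absorb n k) ⟩
    suc n * binom n k * (p * x + p * y) ∎

-- The n + 1 divisors of `D` in row n of the triangle are each at most `D`, and they add up to (n +
-- 1) 2^n.
commonMultiple-large : ∀ {D} n .{{_ : NonZero D}} → (∀ j → 1 ≤ j → j ≤ suc n → j ∣ D) → 2 ^ n ≤ D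
commonMultiple-large {D} n h = *-cancelˡ-≤ (suc n) (begin
  suc n * 2 ^ n       ≡⟨ cong (suc n *_) (rowSum-full n) ⟨
  suc n * rowSum n n  ≤⟨ bound n ≤-refl ⟩
  suc n * D           ∎)
  where
  open ≤-Reasoning
  bound : ∀ m → m ≤ n → suc n * rowSum n m ≤ suc m * D
  bound zero    m≤n = ≤-trans (∣⇒≤ (row-∣ n h 0 m≤n)) (m≤m+n D 0)
  bound (suc m) m≤n = begin
    suc n * (rowSum n m + binom n (suc m))          ≡⟨ *-distribˡ-+ (suc n) (rowSum n m) _ ⟩
    suc n * rowSum n m + suc n * binom n (suc m)    ≤⟨ +-mono-≤ (bound m (<⇒≤ m≤n)) (∣⇒≤ (row-∣ n h (suc m) m≤n)) ⟩
    suc m * D + D                                   ≡⟨ +-comm (suc m * D) D ⟩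
    suc (suc m) * D ∎

-- Divisibility through prime powers

coprime-prime : ∀ {p m} → Prime p → p ∤ m → Coprime m p
coprime-prime pp p∤m (d∣m , d∣p) with prime⇒irreducible pp d∣p
... | inj₁ d≡1  = d≡1
... | inj₂ refl = contradiction d∣m p∤m

strip-primePower : ∀ {p m c} → Prime p → p ∤ m → ∀ e → m ∣ p ^ e * c → m ∣ c
strip-primePower {p} {m} {c} pp p∤m zero    h = subst (m ∣_) (*-identityˡ c) h
strip-primePower {p} {m} {c} pp p∤m (suc e) h = strip-primePower pp p∤m e
  (coprime-divisor (coprime-prime pp p∤m) (subst (m ∣_) (*-assoc p (p ^ e) c) h))

split-primePower : ∀ {p} → Prime p → ∀ k → .{{NonZero k}} → ∃ λ e → ∃ λ m → k ≡ p ^ e * m × p ∤ m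
split-primePower {p} pp = <-rec (λ k → .{{NonZero k}} → ∃ λ e → ∃ λ m → k ≡ p ^ e * m × p ∤ m) go
  where
  go : ∀ k → (∀ {j} → j < k → .{{NonZero j}} → ∃ λ e → ∃ λ m → j ≡ p ^ e * m × p ∤ m) →
       .{{NonZero k}} → ∃ λ e → ∃ λ m → k ≡ p ^ e * m × p ∤ m
  go k rec with p ∣? k
  ... | no p∤k = 0 , k , sym (*-identityˡ k) , p∤k
  ... | yes (divides (suc j) refl) =
        let e , m , eq , p∤m = rec {suc j} (m<m*n (suc j) p (nonTrivial⇒n>1 p {{prime⇒nonTrivial pp}})) in
        suc e , m , trans (*-comm (suc j) p) (trans (cong (p *_) eq) (sym (*-assoc p (p ^ e) m))) , p∤m

prime-divisor : ∀ k → 1 < k → ∃ λ p → Prime p × p ∣ k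
prime-divisor k@(suc (suc _)) _ with factorise k
... | record { factors = []; isFactorisation = () }
... | record { factors = p ∷ ps; isFactorisation = eq; factorsPrime = pp ∷ _ } =
      p , pp , divides (product ps) (trans eq (*-comm p (product ps)))
prime-divisor 1 (s≤s ())

-- Strong induction on `k`: split off its full p-part, which divides `D` by hypothesis. The smaller
-- cofactor divides `D` by induction and is prime to p, so it divides what remains of `D` after the
-- p-part is removed.
primePowers⇒∣ : ∀ D k → .{{NonZero k}} → (∀ p e → Prime p → p ^ e ∣ k → p ^ e ∣ D) → k ∣ D
primePowers⇒∣ D = <-rec (λ k → .{{NonZero k}} → (∀ p e → Prime p → p ^ e ∣ k → p ^ e ∣ D) → k ∣ D) go
  where
  go : ∀ k → (∀ {j} → j < k → .{{NonZero j}} → (∀ p e → Prime p → p ^ e ∣ j → p ^ e ∣ D) → j ∣ D) →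
       .{{NonZero k}} → (∀ p e → Prime p → p ^ e ∣ k → p ^ e ∣ D) → k ∣ D
  go 1 rec h = 1∣ D
  go k@(suc (suc _)) rec h with prime-divisor k (s≤s (s≤s z≤n))
  ... | p , pp , p∣k with split-primePower pp k
  ...   | zero , m , eq , p∤m = contradiction (subst (p ∣_) (trans eq (*-identityˡ m)) p∣k) p∤m
  ...   | suc e , zero , eq , p∤m = contradiction (p ∣0) p∤m
  ...   | suc e , m@(suc _) , eq , p∤m with h p (suc e) pp (divides m (trans eq (*-comm (p ^ suc e) m)))
  ...     | divides c D≡ = subst₂ _∣_ (sym eq) (trans (*-comm (p ^ suc e) c) (sym D≡)) (*-monoʳ-∣ (p ^ suc e)
            (strip-primePower pp p∤m (suc e) (subst (m ∣_) (trans D≡ (*-comm c _))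
              (rec m<k (λ p′ e′ pp′ d → h p′ e′ pp′ (∣-trans d (divides (p ^ suc e) eq)))))))
    where
    m<k : m < k
    m<k = subst (m <_) (sym eq) (subst (_< p ^ suc e * m) (*-identityˡ m)
      (*-monoˡ-< m (<-≤-trans (nonTrivial⇒n>1 p {{prime⇒nonTrivial pp}})
        (m≤m*n p (p ^ e) {{m^n≢0 p e {{prime⇒nonZero pp}}}}))))

-- Products of primes and Chebyshev's argument

primeOrOne : ℕ → ℕ
primeOrOne n = if-dec (prime? n) n 1

-- The product of the primes in (a, a + j]; for a = 0 this is the primorial of j.
primeProduct : ℕ → ℕ → ℕ
primeProduct a zero    = 1
primeProduct a (suc j) = primeOrOne (a + suc j) * primeProduct a j

primeProduct-+ : ∀ a i j → primeProduct a (i + j) ≡ primeProduct (a + i) j * primeProduct a i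
primeProduct-+ a i zero rewrite +-identityʳ i = sym (+-identityʳ _)
primeProduct-+ a i (suc j) rewrite +-suc i j | primeProduct-+ a i j | +-assoc a i (suc j) | +-suc i j =
  sym (*-assoc (primeOrOne (a + suc (i + j))) _ _)

prime∣primeProduct : ∀ {p} n → Prime p → p ≤ n → p ∣ primeProduct 0 n
prime∣primeProduct zero pp p≤ = contradiction p≤ (<⇒≱ (<-trans (s≤s z≤n) (nonTrivial⇒n>1 _ {{prime⇒nonTrivial pp}})))
prime∣primeProduct (suc n) pp p≤ with m≤n⇒m<n∨m≡n p≤
... | inj₁ p<   = ∣n⇒∣m*n (primeOrOne (suc n)) (prime∣primeProduct n pp (≤-pred p<))
... | inj₂ refl = ∣m⇒∣m*n (primeProduct 0 n) (subst (suc n ∣_) (sym (if-yes (prime? (suc n)) pp)) ∣-refl)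

primeOrOne≢0 : ∀ n → NonZero (primeOrOne n)
primeOrOne≢0 n with prime? n
... | yes pp = prime⇒nonZero pp
... | no _   = _

primeProduct≢0 : ∀ a j → NonZero (primeProduct a j)
primeProduct≢0 a zero    = _
primeProduct≢0 a (suc j) = m*n≢0 _ _ {{primeOrOne≢0 (a + suc j)}} {{primeProduct≢0 a j}}

prime∣primeProduct⇒≤ : ∀ {p} a j → Prime p → p ∣ primeProduct a j → p ≤ a + j
prime∣primeProduct⇒≤ a zero    pp h = contradiction (∣⇒≤ h) (<⇒≱ (nonTrivial⇒n>1 _ {{prime⇒nonTrivial pp}}))
prime∣primeProduct⇒≤ {p} a (suc j) pp h with euclidsLemma (primeOrOne (a + suc j)) _ pp h
... | inj₂ h′ = ≤-trans (prime∣primeProduct⇒≤ a j pp h′) (+-monoʳ-≤ a (n≤1+n j))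
... | inj₁ h′ with prime? (a + suc j)
...   | yes pp′ = ∣⇒≤ {{prime⇒nonZero pp′}} h′
...   | no _    = contradiction (∣⇒≤ h′) (<⇒≱ (nonTrivial⇒n>1 _ {{prime⇒nonTrivial pp}}))

n∣n! : ∀ n .{{_ : NonZero n}} → n ∣ n !
n∣n! (suc n) = m∣m*n (n !)

prime∣!⇒≤ : ∀ {p} n → Prime p → p ∣ n ! → p ≤ n
prime∣!⇒≤ zero    pp h = contradiction (∣⇒≤ h) (<⇒≱ (nonTrivial⇒n>1 _ {{prime⇒nonTrivial pp}}))
prime∣!⇒≤ (suc n) pp h with euclidsLemma (suc n) (n !) pp h
... | inj₁ h′ = ∣⇒≤ h′
... | inj₂ h′ = m≤n⇒m≤1+n (prime∣!⇒≤ n pp h′)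

-- Such a prime divides (2n)!, which is the binomial coefficient times n! n!, but it exceeds n and
-- so cannot divide n!.
prime∣centralBinom : ∀ {p} n → Prime p → n < p → p ≤ n + n → p ∣ binom (n + n) n
prime∣centralBinom {p} n pp n<p p≤ with euclidsLemma (binom (n + n) n) (n ! * n !) pp
  (subst (p ∣_) (sym (binom-! n n)) (∣-trans (n∣n! p {{prime⇒nonZero pp}}) (m≤n⇒m!∣n! p≤)))
... | inj₁ h = h
... | inj₂ h with euclidsLemma (n !) (n !) pp h
...   | inj₁ h′ = contradiction (prime∣!⇒≤ n pp h′) (<⇒≱ n<p)
...   | inj₂ h′ = contradiction (prime∣!⇒≤ n pp h′) (<⇒≱ n<p)

-- A new prime exceeds every prime factor of the product collected so far, so it must divide the
-- remaining cofactor.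
primeProduct∣centralBinom : ∀ n j → j ≤ n → primeProduct n j ∣ binom (n + n) n
primeProduct∣centralBinom n zero    _ = 1∣ _
primeProduct∣centralBinom n (suc j) j<n with primeProduct∣centralBinom n j (<⇒≤ j<n) | prime? (n + suc j)
... | ih | no _ = subst (_∣ binom (n + n) n) (sym (+-identityʳ _)) ih
... | divides c eq | yes pp
      with euclidsLemma c (primeProduct n j) pp (subst (n + suc j ∣_) eq
             (prime∣centralBinom n pp (m<m+n n (s≤s z≤n)) (+-monoʳ-≤ n j<n)))
...   | inj₁ h = subst ((n + suc j) * primeProduct n j ∣_) (sym eq) (*-monoˡ-∣ (primeProduct n j) h)
...   | inj₂ h = contradiction (prime∣primeProduct⇒≤ n j pp h) (<⇒≱ (+-monoʳ-< n (n<1+n j)))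

-- Erdős's doubling argument: the primes in (n, 2n] contribute at most binom(2n, n) ≤ 2^(2n), and
-- the exponents 2n + 2n add up to the one claimed for 2n.
primorial-bound : ∀ k → primeProduct 0 (2 ^ k) ≤ 2 ^ (2 * 2 ^ k)
primorial-bound zero = s≤s z≤n
primorial-bound (suc k) = begin
  primeProduct 0 (2 ^ suc k)          ≡⟨ cong (primeProduct 0) (cong (n +_) (+-identityʳ n)) ⟩
  primeProduct 0 (n + n)              ≡⟨ primeProduct-+ 0 n n ⟩
  primeProduct n n * primeProduct 0 n ≤⟨ *-mono-≤ (≤-trans (∣⇒≤ (primeProduct∣centralBinom n n ≤-refl)) (binom≤2^ (n + n) n))
                                            (primorial-bound k) ⟩
  2 ^ (n + n) * 2 ^ (2 * n)           ≡⟨ ^-distribˡ-+-* 2 (n + n) (2 * n) ⟨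
  2 ^ (n + n + 2 * n)                 ≡⟨ cong (2 ^_) (lemma n) ⟩
  2 ^ (2 * 2 ^ suc k)                 ∎
  where
  open ≤-Reasoning
  n = 2 ^ k
  instance _ = >-nonZero (binom-pos (m≤m+n n n))
  lemma : ∀ n → n + n + 2 * n ≡ 2 * (2 * n)
  lemma = solve-∀

!≤^ : ∀ b n → n ≤ b → n ! ≤ b ^ n
!≤^ b zero    _   = ≤-refl
!≤^ b (suc n) n<b = *-mono-≤ n<b (!≤^ b n (<⇒≤ n<b))

^-reflects-≤ : ∀ {p m n} → 1 < p → p ^ m ≤ p ^ n → m ≤ n
^-reflects-≤ {p} {m} {n} 1<p h with m ≤? n
... | yes m≤n = m≤n
... | no m≰n = contradiction h (<⇒≱ (^-monoʳ-< p 1<p (≰⇒> m≰n)))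

^-monoʳ-∣ : ∀ p {i j} → i ≤ j → p ^ i ∣ p ^ j
^-monoʳ-∣ p {i} {j} i≤j = divides (p ^ (j ∸ i)) (trans (cong (p ^_) (sym (m∸n+n≡m i≤j))) (^-distribˡ-+-* p (j ∸ i) i))

^-monoˡ-∣ : ∀ {p r} e → p ∣ r → p ^ e ∣ r ^ e
^-monoˡ-∣ zero    h = ∣-refl
^-monoˡ-∣ (suc e) h = *-pres-∣ h (^-monoˡ-∣ e h)

4*sq≤2^ : ∀ m → 8 ≤ m → 4 * (m * m) ≤ 2 ^ m
4*sq≤2^ m 8≤m = subst (λ m → 4 * (m * m) ≤ 2 ^ m) (m+[n∸m]≡n 8≤m) (go (m ∸ 8))
  where
  open ≤-Reasoning
  square : ∀ d → 2 * (4 * ((8 + d) * (8 + d))) ≡ 4 * ((9 + d) * (9 + d)) + (188 + 56 * d + 4 * (d * d))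
  square = solve-∀
  go : ∀ d → 4 * ((8 + d) * (8 + d)) ≤ 2 ^ (8 + d)
  go zero    = ≤-refl
  go (suc d) rewrite +-suc 8 d = begin
    4 * ((9 + d) * (9 + d)) ≤⟨ m≤m+n _ (188 + 56 * d + 4 * (d * d)) ⟩
    4 * ((9 + d) * (9 + d)) + (188 + 56 * d + 4 * (d * d)) ≡⟨ square d ⟨
    2 * (4 * ((8 + d) * (8 + d))) ≤⟨ *-monoʳ-≤ 2 (go d) ⟩
    2 * 2 ^ (8 + d) ∎

-- If every prime up to 4 ^ m is at most y then (2 ^ m)! ^ 2m times the product of the
-- primes up to y is a common multiple of 1, ..., 4 ^ m: small primes occur in the factorial and
-- primes above 2 ^ m occur at most once in a number up to 4 ^ m.
commonMultiple : ∀ m y → (∀ p → Prime p → p ≤ 2 ^ (m + m) → p ≤ y) →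
                 ∀ k → 1 ≤ k → k ≤ 2 ^ (m + m) → k ∣ ((2 ^ m) !) ^ (m + m) * primeProduct 0 y
commonMultiple m y h k 1≤k k≤N = primePowers⇒∣ _ k {{>-nonZero 1≤k}} pow
  where
  r = 2 ^ m
  open ≤-Reasoning
  pow : ∀ p e → Prime p → p ^ e ∣ k → p ^ e ∣ (r !) ^ (m + m) * primeProduct 0 y
  pow p e pp d with p ≤? r
  ... | yes p≤r = ∣m⇒∣m*n _ (∣-trans (^-monoʳ-∣ p e≤) (^-monoˡ-∣ (m + m) (∣-trans (n∣n! p {{prime⇒nonZero pp}}) (m≤n⇒m!∣n! p≤r))))
    where
    e≤ : e ≤ m + m
    e≤ = ^-reflects-≤ (s≤s (s≤s z≤n)) (begin
      2 ^ e       ≤⟨ ^-monoˡ-≤ e (nonTrivial⇒n>1 p {{prime⇒nonTrivial pp}}) ⟩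
      p ^ e       ≤⟨ ∣⇒≤ {{>-nonZero 1≤k}} d ⟩
      k           ≤⟨ k≤N ⟩
      2 ^ (m + m) ∎)
  pow p zero pp d | no _ = 1∣ _
  pow p (suc zero) pp d | no _ = subst (_∣ _) (sym (*-identityʳ p)) (∣n⇒∣m*n ((r !) ^ (m + m))
    (prime∣primeProduct y pp (h p pp (≤-trans (subst (_≤ k) (*-identityʳ p) (∣⇒≤ {{>-nonZero 1≤k}} d)) k≤N))))
  pow p (suc (suc e)) pp d | no p≰r = contradiction (begin-strict
      2 ^ (m + m) ≡⟨ ^-distribˡ-+-* 2 m m ⟩
      r * r       <⟨ *-mono-< (≰⇒> p≰r) (≰⇒> p≰r) ⟩
      p * p       ≤⟨ *-monoʳ-≤ p (m≤m*n p (p ^ e) {{m^n≢0 p e {{prime⇒nonZero pp}}}}) ⟩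
      p ^ suc (suc e) ≤⟨ ∣⇒≤ {{>-nonZero 1≤k}} d ⟩
      k           ≤⟨ k≤N ⟩
      2 ^ (m + m) ∎) (n≮n _)

-- Put y = 2^j, so that 4^m = 8y. Without a prime in (y, 8y] the common multiple above would be at
-- least 2^(8y - 1). Its factorial part is at most 2^(4y), by r! ≤ r^r for r = 2^m and 4m² ≤ 2^m,
-- and its primorial part at most 2^(2y); but 6y < 8y - 1.
chebyshev : ∀ m j → 8 ≤ m → 3 + j ≡ m + m → ∃ λ p → Prime p × 2 ^ j < p × p ≤ 2 ^ (m + m)
chebyshev m j 8≤m j≡ with Finₚ.any? {n = suc (2 ^ (m + m))} (λ i → prime? (toℕ i) ×-dec (2 ^ j <? toℕ i))
... | yes (i , pp , lt) = toℕ i , pp , lt , ≤-pred (Finₚ.toℕ<n i)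
... | no none = contradiction chain (<⇒≱ upper)
  where
  open ≤-Reasoning
  y = 2 ^ j
  r = 2 ^ m
  N = 2 ^ (m + m)
  D = (r !) ^ (m + m) * primeProduct 0 y
  small : ∀ p → Prime p → p ≤ N → p ≤ y
  small p pp p≤N with p ≤? y
  ... | yes p≤y = p≤y
  ... | no p≰y = contradiction (Fin.fromℕ< (s≤s p≤N) ,
        subst Prime (sym (Finₚ.toℕ-fromℕ< (s≤s p≤N))) pp ,
        subst (y <_) (sym (Finₚ.toℕ-fromℕ< (s≤s p≤N))) (≰⇒> p≰y)) none
  D≢0 : NonZero D
  D≢0 = m*n≢0 _ _ {{m^n≢0 (r !) (m + m) {{r !≢0}}}} {{primeProduct≢0 0 y}}
  N≡ : suc (pred N) ≡ N
  N≡ = suc-pred N {{m^n≢0 2 (m + m)}}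
  lower : 2 ^ pred N ≤ D
  lower = commonMultiple-large (pred N) {{D≢0}} λ k 1≤k k≤ →
    commonMultiple m y small k 1≤k (subst (k ≤_) N≡ k≤)
  D≤ : D ≤ 2 ^ (m * r * (m + m) + 2 * y)
  D≤ = begin
    (r !) ^ (m + m) * primeProduct 0 y ≤⟨ *-mono-≤ (^-monoˡ-≤ (m + m) (!≤^ r r ≤-refl)) (primorial-bound j) ⟩
    (r ^ r) ^ (m + m) * 2 ^ (2 * y)    ≡⟨ cong (λ z → z ^ (m + m) * 2 ^ (2 * y)) (^-*-assoc 2 m r) ⟩
    (2 ^ (m * r)) ^ (m + m) * 2 ^ (2 * y) ≡⟨ cong (_* 2 ^ (2 * y)) (^-*-assoc 2 (m * r) (m + m)) ⟩
    2 ^ (m * r * (m + m)) * 2 ^ (2 * y) ≡⟨ ^-distribˡ-+-* 2 (m * r * (m + m)) (2 * y) ⟨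
    2 ^ (m * r * (m + m) + 2 * y) ∎
  chain : pred N ≤ m * r * (m + m) + 2 * y
  chain = ^-reflects-≤ {2} (s≤s (s≤s z≤n)) (≤-trans lower D≤)
  N≡8y : N ≡ 8 * y
  N≡8y = trans (cong (2 ^_) (sym j≡)) (lemma y)
    where
    lemma : ∀ y → 2 * (2 * (2 * y)) ≡ 8 * y
    lemma = solve-∀
  first : m * r * (m + m) ≤ 4 * y
  first = *-cancelˡ-≤ 2 (begin
    2 * (m * r * (m + m)) ≡⟨ lemma m r ⟩
    4 * (m * m) * r       ≤⟨ *-monoˡ-≤ r (4*sq≤2^ m 8≤m) ⟩
    r * r                 ≡⟨ ^-distribˡ-+-* 2 m m ⟨
    N                     ≡⟨ N≡8y ⟩
    8 * y                 ≡⟨ *-assoc 2 4 y ⟩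
    2 * (4 * y)           ∎)
    where
    lemma : ∀ m r → 2 * (m * r * (m + m)) ≡ 4 * (m * m) * r
    lemma = solve-∀
  upper : m * r * (m + m) + 2 * y < pred N
  upper = ≤-pred (begin-strict
    suc (m * r * (m + m) + 2 * y) ≤⟨ s≤s (+-monoˡ-≤ (2 * y) first) ⟩
    suc (4 * y + 2 * y)           <⟨ +-monoˡ-< (4 * y + 2 * y) {1} {2} ≤-refl ⟩
    2 * 1 + (4 * y + 2 * y)       ≤⟨ +-monoˡ-≤ (4 * y + 2 * y) (*-monoʳ-≤ 2 (m^n>0 2 j)) ⟩
    2 * y + (4 * y + 2 * y)       ≡⟨ lemma y ⟩
    8 * y                         ≡⟨ N≡8y ⟨
    N                             ≡⟨ N≡ ⟨
    suc (pred N)                  ∎)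
    where
    lemma : ∀ y → 2 * y + (4 * y + 2 * y) ≡ 8 * y
    lemma = solve-∀

-- Affine planes

-- An affine plane of order q without one of its parallel classes.
record Plane (q : ℕ) : Set₁ where
  field
    Point Line  : Set
    _≟ᴾ_        : DecidableEquality Point
    _≟ᴸ_        : DecidableEquality Line
    points      : List Point
    lines       : List Line
    allPoints   : ∀ P → P ∈ points
    allLines    : ∀ L → L ∈ lines
    uniquePoints : Unique points
    uniqueLines : Unique lines
    #points     : length points ≡ q * q
    #lines      : length lines ≡ q * q
    _on_        : Point → Line → Set
    _on?_       : ∀ P L → Dec (P on L)
    coord       : Point → Fin q
    coord-injective : ∀ {P Q L} → P on L → Q on L → coord P ≡ coord Q → P ≡ Q
    line-unique : ∀ {P Q L M} → P ≢ Q → P on L → Q on L → P on M → Q on M → L ≡ M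
    degree      : ∀ P → ∑ lines (λ L → [ P on? L ]) ≡ q

  infix 4 _on_ _on?_ _≟ᴾ_ _≟ᴸ_

module _ {q : ℕ} .{{_ : NonZero q}} where

  %≡⇒∣ : ∀ a b → a % q ≡ b % q → q ∣ ∣ a - b ∣
  %≡⇒∣ a b e = divides ∣ a / q - b / q ∣ (begin
    ∣ a - b ∣ ≡⟨ cong₂ ∣_-_∣ (m≡m%n+[m/n]*n a q) (trans (m≡m%n+[m/n]*n b q) (cong (_+ b / q * q) (sym e))) ⟩
    ∣ a % q + a / q * q - a % q + b / q * q ∣ ≡⟨ ∣m+n-m+o∣≡∣n-o∣ (a % q) _ _ ⟩
    ∣ a / q * q - b / q * q ∣ ≡⟨ *-distribʳ-∣-∣ q (a / q) (b / q) ⟨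
    ∣ a / q - b / q ∣ * q ∎)
    where open ≡-Reasoning

  ∣diff⇒≡ : ∀ (x y : Fin q) → q ∣ ∣ toℕ x - toℕ y ∣ → x ≡ y
  ∣diff⇒≡ x y d = Finₚ.toℕ-injective (∣m-n∣≡0⇒m≡n (small _
    (<-≤-trans (s≤s (∣m-n∣≤m⊔n (toℕ x) (toℕ y))) (⊔-lub (Finₚ.toℕ<n x) (Finₚ.toℕ<n y))) d))
    where
    small : ∀ n → n < q → q ∣ n → n ≡ 0
    small zero    _   _ = refl
    small (suc n) n<q d = contradiction (∣⇒≤ d) (<⇒≱ n<q)

  %-+-cong : ∀ a a′ b b′ → a % q ≡ a′ % q → b % q ≡ b′ % q → (a + b) % q ≡ (a′ + b′) % q
  %-+-cong a a′ b b′ e f = trans (%-distribˡ-+ a b q)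
    (trans (cong₂ (λ x y → (x + y) % q) e f) (sym (%-distribˡ-+ a′ b′ q)))

-- The expansion of (m - m′)(x - x′) with its positive and negative terms collected, so that it
-- makes sense in ℕ up to sign.
diff-product : ∀ m m′ x x′ → ∣ m * x + m′ * x′ - m * x′ + m′ * x ∣ ≡ ∣ m - m′ ∣ * ∣ x - x′ ∣
diff-product m m′ x x′ with ≤-total m m′
... | inj₁ m≤m′ = begin
    ∣ m * x + m′ * x′ - m * x′ + m′ * x ∣ ≡⟨ cong (λ z → ∣ m * x + z * x′ - m * x′ + z * x ∣) (sym (m+[n∸m]≡n m≤m′)) ⟩
    ∣ m * x + (m + d) * x′ - m * x′ + (m + d) * x ∣ ≡⟨ cong₂ ∣_-_∣ (lemma₁ m d x x′) (lemma₂ m d x x′) ⟩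
    ∣ m * (x + x′) + d * x′ - m * (x + x′) + d * x ∣ ≡⟨ ∣m+n-m+o∣≡∣n-o∣ (m * (x + x′)) _ _ ⟩
    ∣ d * x′ - d * x ∣ ≡⟨ *-distribˡ-∣-∣ d x′ x ⟨
    d * ∣ x′ - x ∣ ≡⟨ cong₂ _*_ (sym (m≤n⇒∣m-n∣≡n∸m m≤m′)) (∣-∣-comm x′ x) ⟩
    ∣ m - m′ ∣ * ∣ x - x′ ∣ ∎
  where
  open ≡-Reasoning
  d = m′ ∸ m
  lemma₁ : ∀ m d x y → m * x + (m + d) * y ≡ m * (x + y) + d * y
  lemma₁ = solve-∀
  lemma₂ : ∀ m d x y → m * y + (m + d) * x ≡ m * (x + y) + d * x
  lemma₂ = solve-∀
... | inj₂ m′≤m = begin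
    ∣ m * x + m′ * x′ - m * x′ + m′ * x ∣ ≡⟨ cong (λ z → ∣ z * x + m′ * x′ - z * x′ + m′ * x ∣) (sym (m+[n∸m]≡n m′≤m)) ⟩
    ∣ (m′ + d) * x + m′ * x′ - (m′ + d) * x′ + m′ * x ∣ ≡⟨ cong₂ ∣_-_∣ (lemma₁ m′ d x x′) (lemma₂ m′ d x x′) ⟩
    ∣ m′ * (x + x′) + d * x - m′ * (x + x′) + d * x′ ∣ ≡⟨ ∣m+n-m+o∣≡∣n-o∣ (m′ * (x + x′)) _ _ ⟩
    ∣ d * x - d * x′ ∣ ≡⟨ *-distribˡ-∣-∣ d x x′ ⟨
    d * ∣ x - x′ ∣ ≡⟨ cong (_* ∣ x - x′ ∣) (sym (m≤n⇒∣n-m∣≡n∸m m′≤m)) ⟩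
    ∣ m - m′ ∣ * ∣ x - x′ ∣ ∎
  where
  open ≡-Reasoning
  d = m ∸ m′
  lemma₁ : ∀ m d x y → (m + d) * x + m * y ≡ m * (x + y) + d * x
  lemma₁ = solve-∀
  lemma₂ : ∀ m d x y → (m + d) * y + m * x ≡ m * (x + y) + d * y
  lemma₂ = solve-∀

-- The point (x , y) lies on the line (m , c) iff c = m x + y in ℤ/q.
affinePlane : ∀ {q} → Prime q → Plane q
affinePlane {q} pq = record
  { Point = Fin q × Fin q ; Line = Fin q × Fin q
  ; _≟ᴾ_ = ≡-dec Fin._≟_ Fin._≟_ ; _≟ᴸ_ = ≡-dec Fin._≟_ Fin._≟_
  ; points = pairs ; lines = pairs
  ; allPoints = complete ; allLines = complete
  ; uniquePoints = uniquePairs ; uniqueLines = uniquePairs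
  ; #points = size ; #lines = size
  ; _on_ = λ P L → proj₂ L ≡ height (proj₁ L) P
  ; _on?_ = λ P L → proj₂ L Fin.≟ height (proj₁ L) P
  ; coord = proj₁
  ; coord-injective = λ {P} {Q} {L} → coord-inj {P} {Q} {L}
  ; line-unique = λ {P} {Q} {L} {M} → uniq {P} {Q} {L} {M}
  ; degree = λ P → trans (∑-× _,_ (allFin q) (allFin q) _)
      (trans (∑-cong (allFin q) λ m → ∑-exactlyOne (allFin q) (λ c → c Fin.≟ height m P) (Uniqueₚ.allFin⁺ q)
         (λ e f → trans e (sym f)) (∈ₚ.∈-allFin (height m P)) refl)
      (trans (∑-const (allFin q) 1) (trans (*-identityʳ _) (Listₚ.length-tabulate id))))
  }
  where
  instance
    q≢0 : NonZero q
    q≢0 = prime⇒nonZero pq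
  pairs = cartesianProduct (allFin q) (allFin q)
  uniquePairs : Unique pairs
  uniquePairs = Uniqueₚ.cartesianProduct⁺ (Uniqueₚ.allFin⁺ q) (Uniqueₚ.allFin⁺ q)
  complete : ∀ P → P ∈ pairs
  complete (x , y) = ∈ₚ.∈-cartesianProduct⁺ (∈ₚ.∈-allFin x) (∈ₚ.∈-allFin y)
  size : length pairs ≡ q * q
  size = trans (length-× _,_ (allFin q) (allFin q)) (cong₂ _*_ #Fin #Fin)
    where
    #Fin : length (allFin q) ≡ q
    #Fin = Listₚ.length-tabulate id
  value : Fin q → Fin q × Fin q → ℕ
  value m (x , y) = toℕ m * toℕ x + toℕ y
  height : Fin q → Fin q × Fin q → Fin q
  height m P = Fin.fromℕ< (m%n<n (value m P) q)
  height≡ : ∀ m m′ P P′ → height m P ≡ height m′ P′ → value m P % q ≡ value m′ P′ % q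
  height≡ m m′ P P′ e = trans (sym (Finₚ.toℕ-fromℕ< _)) (trans (cong toℕ e) (Finₚ.toℕ-fromℕ< _))
  coord-inj : ∀ {P Q L : Fin q × Fin q} → proj₂ L ≡ height (proj₁ L) P → proj₂ L ≡ height (proj₁ L) Q →
              proj₁ P ≡ proj₁ Q → P ≡ Q
  coord-inj {x , y} {.x , y′} {m , c} e f refl = cong (x ,_) (∣diff⇒≡ y y′
    (subst (q ∣_) (∣m+n-m+o∣≡∣n-o∣ (toℕ m * toℕ x) (toℕ y) (toℕ y′))
      (%≡⇒∣ (value m (x , y)) (value m (x , y′)) (height≡ m m (x , y) (x , y′) (trans (sym e) f)))))
  uniq : ∀ {P Q L M : Fin q × Fin q} → P ≢ Q → proj₂ L ≡ height (proj₁ L) P → proj₂ L ≡ height (proj₁ L) Q →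
         proj₂ M ≡ height (proj₁ M) P → proj₂ M ≡ height (proj₁ M) Q → L ≡ M
  -- Combining the equations of both lines at both points gives q ∣ (m - m′)(x - x′). If x = x′ the
  -- points coincide; otherwise the slopes agree, and then the intercepts do.
  uniq {P@(x , y)} {Q@(x′ , y′)} {L@(m , c)} {M@(m′ , c′)} P≢Q PL QL PM QM
    with euclidsLemma ∣ toℕ m - toℕ m′ ∣ ∣ toℕ x - toℕ x′ ∣ pq (subst (q ∣_) eq
           (%≡⇒∣ (value m P + value m′ Q) (value m Q + value m′ P)
             (%-+-cong (value m P) (value m Q) (value m′ Q) (value m′ P)
               (height≡ m m P Q (trans (sym PL) QL)) (height≡ m′ m′ Q P (trans (sym QM) PM)))))
    where
    lemma : ∀ a y b z → a + y + (b + z) ≡ (y + z) + (a + b)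
    lemma = solve-∀
    lemma′ : ∀ a z b y → a + z + (b + y) ≡ (y + z) + (a + b)
    lemma′ = solve-∀
    eq : ∣ value m P + value m′ Q - value m Q + value m′ P ∣ ≡ ∣ toℕ m - toℕ m′ ∣ * ∣ toℕ x - toℕ x′ ∣
    eq = trans (cong₂ ∣_-_∣ (lemma (toℕ m * toℕ x) (toℕ y) (toℕ m′ * toℕ x′) (toℕ y′))
                            (lemma′ (toℕ m * toℕ x′) (toℕ y′) (toℕ m′ * toℕ x) (toℕ y)))
         (trans (∣m+n-m+o∣≡∣n-o∣ (toℕ y + toℕ y′) _ _) (diff-product (toℕ m) (toℕ m′) (toℕ x) (toℕ x′)))
  ... | inj₂ d = contradiction (coord-inj {P} {Q} {L} PL QL (∣diff⇒≡ x x′ d)) P≢Q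
  ... | inj₁ d with ∣diff⇒≡ m m′ d
  ...   | refl = cong (m ,_) (trans PL (sym PM))

-- Lines meeting a large set in many points

2ab≤a²+b² : ∀ a b → 2 * (a * b) ≤ a * a + b * b
2ab≤a²+b² a b with ≤-total a b
... | inj₁ a≤b = subst (λ b → 2 * (a * b) ≤ a * a + b * b) (m+[n∸m]≡n a≤b)
      (subst (2 * (a * (a + d)) ≤_) (sym (lemma a d)) (m≤m+n _ (d * d)))
  where
  d = b ∸ a
  lemma : ∀ a d → a * a + (a + d) * (a + d) ≡ 2 * (a * (a + d)) + d * d
  lemma = solve-∀
... | inj₂ b≤a = subst (λ a → 2 * (a * b) ≤ a * a + b * b) (m+[n∸m]≡n b≤a)
      (subst (2 * ((b + d) * b) ≤_) (sym (lemma b d)) (m≤m+n _ (d * d)))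
  where
  d = a ∸ b
  lemma : ∀ b d → (b + d) * (b + d) + b * b ≡ 2 * ((b + d) * b) + d * d
  lemma = solve-∀

module SecondMoment {q : ℕ} .{{_ : NonZero q}} (Π : Plane q) where
  open Plane Π

  trace : List Point → Line → ℕ
  trace ps L = ∑ ps (λ P → [ P on? L ])

  ∑-trace : ∀ ps → ∑ lines (trace ps) ≡ length ps * q
  ∑-trace ps = trans (∑-swap lines ps _) (trans (∑-cong ps degree) (∑-const ps q))

  codegree : ∀ P Q → ∑ lines (λ L → [ P on? L ] * [ Q on? L ]) ≤ 1 + [ P ≟ᴾ Q ] * q
  codegree P Q with P ≟ᴾ Q
  ... | yes refl = ≤-trans (subst (∑ lines (λ L → [ P on? L ] * [ P on? L ]) ≤_) (trans (degree P) (sym (+-identityʳ q)))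
          (∑-mono lines λ L → ≤-trans (*-monoʳ-≤ [ P on? L ] ([]≤1 (P on? L))) (≤-reflexive (*-identityʳ _)))) (n≤1+n _)
  ... | no P≢Q = ≤-trans (∑-mono lines λ L → both L)
          (∑-atMostOne lines (λ L → (P on? L) ×-dec (Q on? L)) uniqueLines
            λ (PL , QL) (PM , QM) → line-unique P≢Q PL QL PM QM)
    where
    both : ∀ L → [ P on? L ] * [ Q on? L ] ≤ [ (P on? L) ×-dec (Q on? L) ]
    both L with P on? L | Q on? L
    ... | yes _ | yes _ = ≤-refl
    ... | yes _ | no _  = z≤n
    ... | no _  | _     = z≤n

  -- Double counting of pairs of points on a line: an equal pair lies on q lines, any other pair on
  -- at most one.
  ∑-trace² : ∀ ps → Unique ps → ∑ lines (λ L → trace ps L * trace ps L) ≤ length ps * (length ps + q)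
  ∑-trace² ps u = begin
    ∑ lines (λ L → trace ps L * trace ps L)
      ≡⟨ ∑-cong lines (λ L → trans (sym (∑-*ʳ ps (trace ps L) (λ P → [ P on? L ])))
           (∑-cong ps λ P → sym (∑-*ˡ ps [ P on? L ] (λ Q → [ Q on? L ])))) ⟩
    ∑ lines (λ L → ∑ ps (λ P → ∑ ps (λ Q → [ P on? L ] * [ Q on? L ])))
      ≡⟨ trans (∑-swap lines ps _) (∑-cong ps λ P → ∑-swap lines ps _) ⟩
    ∑ ps (λ P → ∑ ps (λ Q → ∑ lines (λ L → [ P on? L ] * [ Q on? L ])))
      ≤⟨ ∑-mono ps (λ P → ∑-mono ps (codegree P)) ⟩
    ∑ ps (λ P → ∑ ps (λ Q → 1 + [ P ≟ᴾ Q ] * q))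
      ≤⟨ ∑-mono ps row ⟩
    ∑ ps (λ P → length ps + q)
      ≡⟨ ∑-const ps _ ⟩
    length ps * (length ps + q) ∎
    where
    open ≤-Reasoning
    row : ∀ P → ∑ ps (λ Q → 1 + [ P ≟ᴾ Q ] * q) ≤ length ps + q
    row P = begin
      ∑ ps (λ Q → 1 + [ P ≟ᴾ Q ] * q) ≡⟨ ∑-+ ps _ _ ⟩
      ∑ ps (λ _ → 1) + ∑ ps (λ Q → [ P ≟ᴾ Q ] * q)
        ≡⟨ cong₂ _+_ (trans (∑-const ps 1) (*-identityʳ _)) (∑-*ʳ ps q _) ⟩
      length ps + ∑ ps (λ Q → [ P ≟ᴾ Q ]) * q
        ≤⟨ +-monoʳ-≤ (length ps) (*-monoˡ-≤ q (∑-atMostOne ps (P ≟ᴾ_) u λ e f → trans (sym e) f)) ⟩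
      length ps + 1 * q ≡⟨ cong (length ps +_) (*-identityˡ q) ⟩
      length ps + q ∎

  -- The mean trace is C = 2(1 + 2s). Summing `pointwise` and dividing by C gives 2C q² ≤ C q² + q²
  -- + C g + 2s q² for the number g of rich lines, that is (C - 1 - 2s) q² ≤ C g. The value of C
  -- makes the left side exactly half of C q².
  manyRichLines : ∀ s ps → Unique ps → length ps ≡ 2 * (1 + 2 * s) * q →
                  q * q ≤ 2 * ∑ lines (λ L → [ s ≤? trace ps L ])
  manyRichLines s ps uniq len = *-cancelˡ-≤ u (+-cancelˡ-≤ (3 * (u * (q * q))) _ _ (begin
    3 * (u * (q * q)) + u * (q * q)     ≡⟨ lemma₁ u (q * q) ⟩
    2 * C * (q * q)                     ≤⟨ *-cancelˡ-≤ C scaled ⟩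
    q * (C * q + q) + (C * g + q * q * (2 * s)) ≡⟨ lemma₂ s q g ⟩
    3 * (u * (q * q)) + u * (2 * g)     ∎))
    where
    open ≤-Reasoning
    u = 1 + 2 * s
    C = 2 * u
    g = ∑ lines (λ L → [ s ≤? trace ps L ])
    lemma₁ : ∀ u n → 3 * (u * n) + u * n ≡ 2 * (2 * u) * n
    lemma₁ = solve-∀
    lemma₂ : ∀ s q g → q * (2 * (1 + 2 * s) * q + q) + (2 * (1 + 2 * s) * g + q * q * (2 * s))
                       ≡ 3 * ((1 + 2 * s) * (q * q)) + (1 + 2 * s) * (2 * g)
    lemma₂ = solve-∀
    lemma₃ : ∀ C q → C * (2 * C * (q * q)) ≡ 2 * C * (C * q * q)
    lemma₃ = solve-∀
    lemma₄ : ∀ C q g s → C * q * (C * q + q) + (C * C * g + q * q * (2 * (C * s)))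
                         ≡ C * (q * (C * q + q) + (C * g + q * q * (2 * s)))
    lemma₄ = solve-∀
    -- A rich line pays C² to complete the square at the mean C; on a poor line the trace is below
    -- s, and 2Cs alone suffices.
    pointwise : ∀ L → 2 * C * trace ps L ≤ trace ps L * trace ps L + (C * C * [ s ≤? trace ps L ] + 2 * (C * s))
    pointwise L with trace ps L | s ≤? trace ps L
    ... | k | yes _ = begin
      2 * C * k             ≡⟨ trans (*-assoc 2 C k) (cong (2 *_) (*-comm C k)) ⟩
      2 * (k * C)           ≤⟨ 2ab≤a²+b² k C ⟩
      k * k + C * C         ≤⟨ +-monoʳ-≤ (k * k) (≤-trans (≤-reflexive (sym (*-identityʳ (C * C)))) (m≤m+n _ _)) ⟩
      k * k + (C * C * 1 + 2 * (C * s)) ∎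
    ... | k | no s≰k = begin
      2 * C * k             ≡⟨ *-assoc 2 C k ⟩
      2 * (C * k)           ≤⟨ *-monoʳ-≤ 2 (*-monoʳ-≤ C (<⇒≤ (≰⇒> s≰k))) ⟩
      2 * (C * s)           ≤⟨ m≤n+m _ (C * C * 0) ⟩
      C * C * 0 + 2 * (C * s) ≤⟨ m≤n+m _ (k * k) ⟩
      k * k + (C * C * 0 + 2 * (C * s)) ∎
    scaled : C * (2 * C * (q * q)) ≤ C * (q * (C * q + q) + (C * g + q * q * (2 * s)))
    scaled = begin
      C * (2 * C * (q * q))  ≡⟨ lemma₃ C q ⟩
      2 * C * (C * q * q)    ≡⟨ cong (λ w → 2 * C * (w * q)) len ⟨
      2 * C * (length ps * q) ≡⟨ cong (2 * C *_) (∑-trace ps) ⟨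
      2 * C * ∑ lines (trace ps) ≡⟨ ∑-*ˡ lines (2 * C) (trace ps) ⟨
      ∑ lines (λ L → 2 * C * trace ps L) ≤⟨ ∑-mono lines pointwise ⟩
      ∑ lines (λ L → trace ps L * trace ps L + (C * C * [ s ≤? trace ps L ] + 2 * (C * s)))
        ≡⟨ trans (∑-+ lines _ _) (cong (∑ lines (λ L → trace ps L * trace ps L) +_) (∑-+ lines _ _)) ⟩
      ∑ lines (λ L → trace ps L * trace ps L) + (∑ lines (λ L → C * C * [ s ≤? trace ps L ]) + ∑ lines (λ _ → 2 * (C * s)))
        ≤⟨ +-mono-≤ (∑-trace² ps uniq) (≤-reflexive (cong₂ _+_ (∑-*ˡ lines (C * C) _)
             (trans (∑-const lines _) (cong (_* (2 * (C * s))) #lines)))) ⟩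
      length ps * (length ps + q) + (C * C * g + q * q * (2 * (C * s)))
        ≡⟨ cong (λ w → w * (w + q) + (C * C * g + q * q * (2 * (C * s)))) len ⟩
      C * q * (C * q + q) + (C * C * g + q * q * (2 * (C * s))) ≡⟨ lemma₄ C q g s ⟩
      C * (q * (C * q + q) + (C * g + q * q * (2 * s))) ∎

-- Random selections and colourings of the lines

lookup-injective : ∀ {xs : List A} → Unique xs → ∀ {i j} → List.lookup xs i ≡ List.lookup xs j → i ≡ j
lookup-injective (_ ∷ _)  {zero}  {zero}  e = refl
lookup-injective {xs = _ ∷ xs} (x∉ ∷ _) {zero}  {suc j} e = contradiction e (All.lookup x∉ (∈ₚ.∈-lookup j))
lookup-injective {xs = _ ∷ xs} (x∉ ∷ _) {suc i} {zero}  e = contradiction (sym e) (All.lookup x∉ (∈ₚ.∈-lookup i))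
lookup-injective (_ ∷ u)  {suc i} {suc j} e = cong suc (lookup-injective u e)

length-allFin : ∀ n → length (allFin n) ≡ n
length-allFin n = Listₚ.length-tabulate id

-- Only one rainbow pattern is counted, colour j at position `v j`, because this event is a product
-- over positions. Each of the s positions costs a factor s, whence the probability s^(-s).
rainbow-count : ∀ {q s} (v : Fin s → Fin q) → (∀ {i j} → v i ≡ v j → i ≡ j) →
  s ^ q ≤ ∑ (allVecs (allFin s) q) (λ χ → ∏ (allFin s) (λ j → [ Vec.lookup χ (v j) Fin.≟ j ])) * s ^ s
rainbow-count {q} {s} v v-inj = begin
  s ^ q                                       ≡⟨ trans (∏-const (allFin q) s) (cong (s ^_) (length-allFin q)) ⟨
  ∏ (allFin q) (λ _ → s)                      ≤⟨ ∏-mono (allFin q) local ⟩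
  ∏ (allFin q) (λ x → S x * E x)              ≡⟨ ∏-* (allFin q) S E ⟩
  ∏ (allFin q) S * ∏ (allFin q) E             ≡⟨ cong₂ _*_ (sym (∑-allVecs-∏ (allFin s) q g)) ∏E ⟩
  ∑ (allVecs (allFin s) q) (λ χ → ∏ (allFin q) (λ x → g x (Vec.lookup χ x))) * s ^ s
    ≤⟨ *-monoˡ-≤ (s ^ s) (∑-mono (allVecs (allFin s) q) λ χ →
         ≤-trans (≤-reflexive (∏-swap (allFin q) (allFin s) _)) (∏-mono (allFin s) (factor χ))) ⟩
  _ ∎
  where
  open ≤-Reasoning
  -- The requirement of index j as seen from position x: it is void unless x = `v j`. Exchanging the
  -- products over j and x makes the event factor over positions.
  h : Fin q → Fin s → Fin s → ℕ
  h x j c = if-dec (x Fin.≟ v j) [ c Fin.≟ j ] 1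
  g : Fin q → Fin s → ℕ
  g x c = ∏ (allFin s) (λ j → h x j c)
  S E : Fin q → ℕ
  S x = ∑ (allFin s) (g x)
  E x = ∏ (allFin s) (λ j → if-dec (x Fin.≟ v j) s 1)
  ∏E : ∏ (allFin q) E ≡ s ^ s
  ∏E = trans (∏-swap (allFin q) (allFin s) _) (trans (∏-cong (allFin s) λ j →
         trans (sym (*-identityʳ _)) (trans (∏-exchange Fin._≟_ (allFin q) (Uniqueₚ.allFin⁺ q) (∈ₚ.∈-allFin (v j)) s (λ _ → 1))
           (trans (cong (_* s) (trans (∏-const (allFin q) 1) (^-zeroˡ (length (allFin q))))) (*-identityˡ s))))
         (trans (∏-const (allFin s) s) (cong (s ^_) (length-allFin s))))
  h≤1 : ∀ x j c → h x j c ≤ 1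
  h≤1 x j c with x Fin.≟ v j
  ... | yes _ = []≤1 (c Fin.≟ j)
  ... | no _  = ≤-refl
  factor : ∀ χ j → ∏ (allFin q) (λ x → h x j (Vec.lookup χ x)) ≤ [ Vec.lookup χ (v j) Fin.≟ j ]
  factor χ j with Vec.lookup χ (v j) Fin.≟ j
  ... | yes _ = ∏≤1 (allFin q) (λ x → h≤1 x j _)
  ... | no ne = ≤-reflexive (∏-zero (allFin q) (∈ₚ.∈-allFin (v j))
                  (trans (if-yes (v j Fin.≟ v j) refl) ([]-no (Vec.lookup χ (v j) Fin.≟ j) ne)))
  -- At a position x = `v j` injectivity leaves j as an allowed colour and `E x` supplies the factor
  -- s; elsewhere all s colours are allowed.
  local : ∀ x → s ≤ S x * E x
  local x with Finₚ.any? (λ j → x Fin.≟ v j)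
  ... | yes (j , refl) = begin
    s               ≡⟨ *-identityˡ s ⟨
    1 * s           ≤⟨ *-mono-≤ one (subst (_≤ E (v j)) (if-yes (v j Fin.≟ v j) refl) (∏-term (allFin s) pos (∈ₚ.∈-allFin j))) ⟩
    S (v j) * E (v j) ∎
    where
    1≤s : 1 ≤ s
    1≤s = ≤-trans (s≤s z≤n) (Finₚ.toℕ<n j)
    pos : ∀ i → 1 ≤ if-dec (v j Fin.≟ v i) s 1
    pos i with v j Fin.≟ v i
    ... | yes _ = 1≤s
    ... | no _  = ≤-refl
    one : 1 ≤ S (v j)
    one = subst (_≤ S (v j)) (∏-one (allFin s) λ i _ → hit i) (∑-term (allFin s) (g (v j)) (∈ₚ.∈-allFin j))
      where
      hit : ∀ i → h (v j) i j ≡ 1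
      hit i with v j Fin.≟ v i
      ... | yes e = []-yes (j Fin.≟ i) (v-inj e)
      ... | no _  = refl
  ... | no none = begin
    s       ≡⟨ trans (∑-const (allFin s) 1) (trans (*-identityʳ _) (length-allFin s)) ⟨
    ∑ (allFin s) (λ _ → 1) ≡⟨ ∑-cong (allFin s) (λ c → sym (∏-one (allFin s) λ j _ → if-no (x Fin.≟ v j) λ e → none (j , e))) ⟩
    S x     ≡⟨ *-identityʳ (S x) ⟨
    S x * 1 ≡⟨ cong (S x *_) (sym (∏-one (allFin s) λ j _ → if-no (x Fin.≟ v j) λ e → none (j , e))) ⟩
    S x * E x ∎

-- 1 - k/q ≤ (1 - 1/q) ^ k, with denominators cleared.
bernoulli : ∀ p k → (suc p ∸ k) * suc p ^ k ≤ suc p * p ^ k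
bernoulli p zero = ≤-refl
bernoulli p (suc k) = begin
  (suc p ∸ suc k) * (suc p * suc p ^ k)  ≡⟨ *-assoc (suc p ∸ suc k) (suc p) _ ⟨
  (p ∸ k) * suc p * suc p ^ k            ≤⟨ *-monoˡ-≤ (suc p ^ k) step ⟩
  (suc p ∸ k) * p * suc p ^ k            ≡⟨ lemma (suc p ∸ k) p (suc p ^ k) ⟩
  p * ((suc p ∸ k) * suc p ^ k)          ≤⟨ *-monoʳ-≤ p (bernoulli p k) ⟩
  p * (suc p * p ^ k)                    ≡⟨ lemma′ p (suc p) (p ^ k) ⟩
  suc p * (p * p ^ k)                    ∎
  where
  open ≤-Reasoning
  lemma : ∀ a p x → a * p * x ≡ p * (a * x)
  lemma = solve-∀
  lemma′ : ∀ a p x → a * (p * x) ≡ p * (a * x)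
  lemma′ = solve-∀
  step : (p ∸ k) * suc p ≤ (suc p ∸ k) * p
  step with k ≤? p
  ... | yes k≤p = begin
    (p ∸ k) * suc p      ≡⟨ *-suc (p ∸ k) p ⟩
    (p ∸ k) + (p ∸ k) * p ≤⟨ +-monoˡ-≤ _ (m∸n≤m p k) ⟩
    p + (p ∸ k) * p      ≡⟨⟩
    suc (p ∸ k) * p      ≡⟨ cong (_* p) (sym (+-∸-assoc 1 k≤p)) ⟩
    (suc p ∸ k) * p      ∎
  ... | no k≰p = subst (λ z → z * suc p ≤ (suc p ∸ k) * p) (sym (m≤n⇒m∸n≡0 (<⇒≤ (≰⇒> k≰p)))) z≤n

-- For positive p, with q = p + 1, Bernoulli's inequality gives (1 + 1/p)^q ≥ 1 + q/p ≥ 2; `growth`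
-- is that inequality with denominators cleared.
2*p^q≤q^q : ∀ p → 2 * p ^ suc p ≤ suc p ^ suc p
2*p^q≤q^q zero = z≤n
2*p^q≤q^q p@(suc _) = *-cancelʳ-≤ _ _ p (begin
  2 * p ^ suc p * p        ≡⟨ lemma (p ^ suc p) p ⟩
  p ^ suc p * (p + p)      ≤⟨ *-monoʳ-≤ (p ^ suc p) (+-monoʳ-≤ p (n≤1+n p)) ⟩
  p ^ suc p * (p + suc p)  ≤⟨ growth (suc p) ⟩
  suc p ^ suc p * p        ∎)
  where
  open ≤-Reasoning
  lemma : ∀ x p → 2 * x * p ≡ x * (p + p)
  lemma = solve-∀
  growth : ∀ n → p ^ n * (p + n) ≤ suc p ^ n * p
  growth zero    = ≤-reflexive (cong (1 *_) (+-identityʳ p))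
  growth (suc n) = begin
    p * p ^ n * (p + suc n)        ≡⟨ *-assoc p (p ^ n) (p + suc n) ⟩
    p * (p ^ n * (p + suc n))      ≤⟨ m≤m+n _ (p ^ n * n) ⟩
    p * (p ^ n * (p + suc n)) + p ^ n * n ≡⟨ lemma₂ p (p ^ n) n ⟩
    suc p * (p ^ n * (p + n))      ≤⟨ *-monoʳ-≤ (suc p) (growth n) ⟩
    suc p * (suc p ^ n * p)        ≡⟨ *-assoc (suc p) (suc p ^ n) p ⟨
    suc p ^ suc n * p              ∎
    where
    lemma₂ : ∀ p x n → p * (x * (p + suc n)) + x * n ≡ suc p * (x * (p + n))
    lemma₂ = solve-∀

^-distribʳ-* : ∀ a b n → (a * b) ^ n ≡ a ^ n * b ^ n
^-distribʳ-* a b zero    = refl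
^-distribʳ-* a b (suc n) = trans (cong (a * b *_) (^-distribʳ-* a b n)) (lemma a b (a ^ n) (b ^ n))
  where
  lemma : ∀ a b c d → a * b * (c * d) ≡ a * c * (b * d)
  lemma = solve-∀

-- Among g factors 1 - 1/q there are h blocks of q factors, and each block is at most 1/2.
halving : ∀ p h g → suc p * h ≤ g → p ^ g * 2 ^ h ≤ suc p ^ g
halving p h g qh≤g = begin
  p ^ g * 2 ^ h                    ≡⟨ cong (λ g → p ^ g * 2 ^ h) (sym (m+[n∸m]≡n qh≤g)) ⟩
  p ^ (q * h + r) * 2 ^ h          ≡⟨ cong (_* 2 ^ h) (^-distribˡ-+-* p (q * h) r) ⟩
  p ^ (q * h) * p ^ r * 2 ^ h      ≡⟨ lemma (p ^ (q * h)) (p ^ r) (2 ^ h) ⟩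
  2 ^ h * p ^ (q * h) * p ^ r      ≡⟨ cong (λ z → 2 ^ h * z * p ^ r) (sym (^-*-assoc p q h)) ⟩
  2 ^ h * (p ^ q) ^ h * p ^ r      ≡⟨ cong (_* p ^ r) (^-distribʳ-* 2 (p ^ q) h) ⟨
  (2 * p ^ q) ^ h * p ^ r          ≤⟨ *-mono-≤ (^-monoˡ-≤ h (2*p^q≤q^q p)) (^-monoˡ-≤ r (n≤1+n p)) ⟩
  (q ^ q) ^ h * q ^ r              ≡⟨ cong (_* q ^ r) (^-*-assoc q q h) ⟩
  q ^ (q * h) * q ^ r              ≡⟨ ^-distribˡ-+-* q (q * h) r ⟨
  q ^ (q * h + r)                  ≡⟨ cong (q ^_) (m+[n∸m]≡n qh≤g) ⟩
  q ^ g                            ∎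
  where
  open ≤-Reasoning
  q = suc p
  r = g ∸ q * h
  lemma : ∀ a b c → a * b * c ≡ c * a * b
  lemma = solve-∀

bit : Bool → ℕ
bit true  = 1
bit false = 0

∑-replicate : ∀ n (x : A) f → ∑ (replicate n x) f ≡ n * f x
∑-replicate zero    x f = refl
∑-replicate (suc n) x f = cong (f x +_) (∑-replicate n x f)

module Random (s q k : ℕ) .{{_ : NonZero s}} .{{_ : NonZero q}} (Π : Plane q) (b≤q : k * s ^ s ≤ q) where
  open Plane Π
  open SecondMoment Π

  -- The factor s^s compensates the probability of the prescribed colours: s given points of a line
  -- are joined in the prescribed way with probability at least k/q.
  b : ℕ
  b = k * s ^ s

  Choice : Set
  Choice = Bool × Vec (Fin s) q

  colourings : List (Vec (Fin s) q)
  colourings = allVecs (allFin s) q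

  -- A list with repetitions serves as the distribution: a line is selected with probability b / q.
  choices : List Choice
  choices = cartesianProduct (replicate b true ++ replicate (q ∸ b) false) colourings

  β : ℕ
  β = q * s ^ q

  #colourings : length colourings ≡ s ^ q
  #colourings = trans (length-allVecs (allFin s) q) (cong (_^ q) (length-allFin s))

  #choices : length choices ≡ β
  #choices = trans (length-× _,_ (replicate b true ++ replicate (q ∸ b) false) colourings) (cong₂ _*_
    (trans (Listₚ.length-++ (replicate b true)) (trans (cong₂ _+_ (Listₚ.length-replicate b) (Listₚ.length-replicate (q ∸ b)))
      (m+[n∸m]≡n b≤q))) #colourings)

  β≢0 : NonZero β
  β≢0 = m*n≢0 q (s ^ q)
    where instance _ = m^n≢0 s q

  ∑-selected : ∀ f → ∑ choices (λ d → bit (proj₁ d) * f (proj₂ d)) ≡ b * ∑ colourings f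
  ∑-selected f = begin
    ∑ choices (λ d → bit (proj₁ d) * f (proj₂ d))
      ≡⟨ ∑-× _,_ (replicate b true ++ replicate (q ∸ b) false) colourings _ ⟩
    ∑ (replicate b true ++ replicate (q ∸ b) false) (λ x → ∑ colourings (λ χ → bit x * f χ))
      ≡⟨ ∑-++ (replicate b true) _ _ ⟩
    ∑ (replicate b true) (λ x → ∑ colourings (λ χ → bit x * f χ)) +
    ∑ (replicate (q ∸ b) false) (λ x → ∑ colourings (λ χ → bit x * f χ))
      ≡⟨ cong₂ _+_ (∑-replicate b true _) (∑-replicate (q ∸ b) false _) ⟩
    b * ∑ colourings (λ χ → 1 * f χ) + (q ∸ b) * ∑ colourings (λ χ → 0 * f χ)
      ≡⟨ cong₂ _+_ (cong (b *_) (trans (∑-*ˡ colourings 1 f) (*-identityˡ _)))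
           (trans (cong ((q ∸ b) *_) (∑-zero colourings)) (*-zeroʳ (q ∸ b))) ⟩
    b * ∑ colourings f + 0 ≡⟨ +-identityʳ _ ⟩
    b * ∑ colourings f ∎
    where open ≡-Reasoning

  -- The share of one line in the event that all of `ls` is selected; the product over all lines is
  -- the indicator of that event.
  selCost : List Line → Line → Choice → ℕ
  selCost []       L d = 1
  selCost (l ∷ ls) L d = if-dec (L ≟ᴸ l) (bit (proj₁ d)) (selCost ls L d)

  selCost≡1 : ∀ ls L d → (L ∈ ls → proj₁ d ≡ true) → selCost ls L d ≡ 1
  selCost≡1 []       L d h = refl
  selCost≡1 (l ∷ ls) L d h with L ≟ᴸ l
  ... | yes e = cong bit (h (here e))
  ... | no _  = selCost≡1 ls L d (h ∘ there)

  ∑-one : ∑ choices (λ _ → 1) ≡ β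
  ∑-one = trans (∑-const choices 1) (trans (*-identityʳ _) #choices)

  ∑-selCost-∷ : ∀ l ls L → ∑ choices (selCost (l ∷ ls) L) ≡ if-dec (L ≟ᴸ l) (b * s ^ q) (∑ choices (selCost ls L))
  ∑-selCost-∷ l ls L with L ≟ᴸ l
  ... | yes _ = trans (∑-cong choices λ d → sym (*-identityʳ (bit (proj₁ d)))) (trans (∑-selected (λ _ → 1))
                  (cong (b *_) (trans (∑-const colourings 1) (trans (*-identityʳ _) #colourings))))
  ... | no _  = refl

  ∑-selCost-∉ : ∀ ls L → L ∉ ls → ∑ choices (selCost ls L) ≡ β
  ∑-selCost-∉ ls L L∉ = trans (∑-cong choices λ d → selCost≡1 ls L d λ L∈ → contradiction L∈ L∉) ∑-one

  -- Distinct lines are selected independently, so the probability is (b/q)^r. The list is consumed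
  -- by trading, for each of its lines, the factor `β` of an unconstrained line for `b * s ^ q`.
  selCost-expectation : ∀ ls → Unique ls →
    ∏ lines (λ L → ∑ choices (selCost ls L)) * q ^ length ls ≡ b ^ length ls * β ^ length lines
  selCost-expectation ls u = *-cancelʳ-≡ _ _ ((s ^ q) ^ length ls) {{m^n≢0 (s ^ q) (length ls) {{m^n≢0 s q}}}} (begin
    X * q ^ r * (s ^ q) ^ r     ≡⟨ *-assoc X (q ^ r) _ ⟩
    X * (q ^ r * (s ^ q) ^ r)   ≡⟨ cong (X *_) (^-distribʳ-* q (s ^ q) r) ⟨
    X * β ^ r                   ≡⟨ go ls u ⟩
    (b * s ^ q) ^ r * B         ≡⟨ cong (_* B) (^-distribʳ-* b (s ^ q) r) ⟩
    b ^ r * (s ^ q) ^ r * B     ≡⟨ lemma (b ^ r) _ B ⟩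
    b ^ r * B * (s ^ q) ^ r     ∎)
    where
    open ≡-Reasoning
    r = length ls
    X = ∏ lines (λ L → ∑ choices (selCost ls L))
    B = β ^ length lines
    lemma : ∀ a b c → a * b * c ≡ a * c * b
    lemma = solve-∀
    go : ∀ ls → Unique ls →
         ∏ lines (λ L → ∑ choices (selCost ls L)) * β ^ length ls ≡ (b * s ^ q) ^ length ls * B
    go [] _ = trans (*-identityʳ _) (trans (trans (∏-cong lines λ _ → ∑-one) (∏-const lines β)) (sym (*-identityˡ B)))
    go (l ∷ ls) (l∉ ∷ u) = begin
      ∏ lines (λ L → ∑ choices (selCost (l ∷ ls) L)) * (β * β ^ n)
        -- One `β` is rewritten as the sum at `l`, unconstrained because `l` does not recur in the
        -- list; this is the factor to be exchanged.
        ≡⟨ cong₂ (λ x y → x * (y * β ^ n)) (∏-cong lines (∑-selCost-∷ l ls)) (sym (∑-selCost-∉ ls l λ l∈ → All.lookup l∉ l∈ refl)) ⟩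
      Y * (∑ choices (selCost ls l) * β ^ n) ≡⟨ *-assoc Y _ _ ⟨
      Y * ∑ choices (selCost ls l) * β ^ n
        ≡⟨ cong (_* β ^ n) (∏-exchange _≟ᴸ_ lines uniqueLines (allLines l) α (λ L → ∑ choices (selCost ls L))) ⟩
      Z * α * β ^ n         ≡⟨ lemma₂ Z α (β ^ n) ⟩
      α * (Z * β ^ n)       ≡⟨ cong (α *_) (go ls u) ⟩
      α * (α ^ n * B)       ≡⟨ *-assoc α _ B ⟨
      α ^ suc n * B         ∎
      where
      α = b * s ^ q
      n = length ls
      Y = ∏ lines (λ L → if-dec (L ≟ᴸ l) α (∑ choices (selCost ls L)))
      Z = ∏ lines (λ L → ∑ choices (selCost ls L))
      lemma₂ : ∀ a b c → a * b * c ≡ b * (a * c)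
      lemma₂ = solve-∀

  on-line : List Point → Line → List Point
  on-line ps L = filter (_on? L) ps

  length-on-line : ∀ ps L → length (on-line ps L) ≡ trace ps L
  length-on-line []       L = refl
  length-on-line (P ∷ ps) L with P on? L
  ... | yes _ = cong suc (length-on-line ps L)
  ... | no _  = length-on-line ps L

  pick : ∀ ps L → s ≤ trace ps L → Fin s → Point
  pick ps L rich j = List.lookup (on-line ps L) (Fin.inject≤ j (subst (s ≤_) (sym (length-on-line ps L)) rich))

  pick-on : ∀ ps L rich j → pick ps L rich j ∈ ps × pick ps L rich j on L
  pick-on ps L rich j = ∈ₚ.∈-filter⁻ (_on? L) {xs = ps} (∈ₚ.∈-lookup (Fin.inject≤ j _))

  pick-injective : ∀ ps L rich → Unique ps → ∀ {i j} → coord (pick ps L rich i) ≡ coord (pick ps L rich j) → i ≡ j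
  pick-injective ps L rich u {i} {j} e = Finₚ.inject≤-injective _ _ i j (lookup-injective (Uniqueₚ.filter⁺ (_on? L) u)
    (coord-injective (proj₂ (pick-on ps L rich i)) (proj₂ (pick-on ps L rich j)) e))

  success : (Fin s → Fin q) → Choice → ℕ
  success v (sel , χ) = bit sel * ∏ (allFin s) (λ j → [ Vec.lookup χ (v j) Fin.≟ j ])

  success≤1 : ∀ v d → success v d ≤ 1
  success≤1 v (true , χ)  = subst (_≤ 1) (sym (*-identityˡ _)) (∏≤1 (allFin s) λ j → []≤1 (Vec.lookup χ (v j) Fin.≟ j))
  success≤1 v (false , χ) = z≤n

  -- Tests only the s points chosen by `pick`, with colour j on the j-th. Poor lines always fail, so
  -- the product over the lines vanishes exactly when some rich line succeeds.
  fail : List Point → Line → Choice → ℕ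
  fail ps L d with s ≤? trace ps L
  ... | yes rich = 1 ∸ success (λ j → coord (pick ps L rich j)) d
  ... | no _     = 1

  fail≡0 : ∀ ps L d → fail ps L d ≡ 0 → Σ (s ≤ trace ps L) λ rich →
           proj₁ d ≡ true × (∀ j → Vec.lookup (proj₂ d) (coord (pick ps L rich j)) ≡ j)
  fail≡0 ps L d e with s ≤? trace ps L
  ... | yes rich = rich , split d (m∸n≡0⇒m≤n e)
    where
    split : ∀ d → 1 ≤ success (λ j → coord (pick ps L rich j)) d →
            proj₁ d ≡ true × (∀ j → Vec.lookup (proj₂ d) (coord (pick ps L rich j)) ≡ j)
    split d@(true , χ) h = refl , λ j → []≡1 (Vec.lookup χ (coord (pick ps L rich j)) Fin.≟ j)
      (∏≡1 (allFin s) _ (trans (sym (*-identityˡ _)) (≤-antisym (success≤1 _ d) h)) (∈ₚ.∈-allFin j))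

  -- Failure on a rich line has probability at most 1 - k/q ≤ (1 - 1/q)^k. With the indicator in the
  -- exponent the bound also holds on poor lines and can be multiplied over all lines.
  fail-expectation : ∀ ps L → Unique ps →
    ∑ choices (fail ps L) * (q ^ k) ^ [ s ≤? trace ps L ] ≤ (pred q ^ k) ^ [ s ≤? trace ps L ] * β
  fail-expectation ps L u with s ≤? trace ps L
  ... | no _     = ≤-reflexive (trans (*-identityʳ _) (trans ∑-one (sym (*-identityˡ β))))
  ... | yes rich = begin
    F * (q ^ k * 1)              ≡⟨ cong (F *_) (*-identityʳ (q ^ k)) ⟩
    F * q ^ k                    ≤⟨ *-monoˡ-≤ (q ^ k) F≤ ⟩
    (q ∸ k) * s ^ q * q ^ k      ≡⟨ lemma (q ∸ k) (s ^ q) (q ^ k) ⟩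
    (q ∸ k) * q ^ k * s ^ q      ≤⟨ *-monoˡ-≤ (s ^ q) (subst
                                      (λ q′ → (q′ ∸ k) * q′ ^ k ≤ q′ * pred q ^ k) (suc-pred q) (bernoulli (pred q) k)) ⟩
    q * pred q ^ k * s ^ q       ≡⟨ lemma₂ q (pred q ^ k) (s ^ q) ⟩
    pred q ^ k * 1 * β           ∎
    where
    open ≤-Reasoning
    v = λ j → coord (pick ps L rich j)
    F = ∑ choices (λ d → 1 ∸ success v d)
    lemma : ∀ a b c → a * b * c ≡ a * c * b
    lemma = solve-∀
    lemma₂ : ∀ q x y → q * x * y ≡ x * 1 * (q * y)
    lemma₂ = solve-∀
    total : F + ∑ choices (success v) ≡ β
    total = trans (sym (∑-+ choices _ _)) (trans (∑-cong choices λ d → m∸n+n≡m (success≤1 v d)) ∑-one)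
    T = ∑ colourings (λ χ → ∏ (allFin s) (λ j → [ Vec.lookup χ (v j) Fin.≟ j ]))
    many : k * s ^ q ≤ ∑ choices (success v)
    many = begin
      k * s ^ q        ≤⟨ *-monoʳ-≤ k (rainbow-count v (pick-injective ps L rich u)) ⟩
      k * (T * s ^ s)  ≡⟨ lemma₃ k T (s ^ s) ⟩
      b * T            ≡⟨ ∑-selected (λ χ → ∏ (allFin s) (λ j → [ Vec.lookup χ (v j) Fin.≟ j ])) ⟨
      ∑ choices (success v) ∎
      where
      lemma₃ : ∀ a b c → a * (b * c) ≡ a * c * b
      lemma₃ = solve-∀
    F≤ : F ≤ (q ∸ k) * s ^ q
    F≤ = begin
      F                          ≡⟨ m+n∸n≡m F (∑ choices (success v)) ⟨
      F + ∑ choices (success v) ∸ ∑ choices (success v) ≡⟨ cong (_∸ ∑ choices (success v)) total ⟩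
      β ∸ ∑ choices (success v)  ≤⟨ ∸-monoʳ-≤ β many ⟩
      q * s ^ q ∸ k * s ^ q      ≡⟨ *-distribʳ-∸ (s ^ q) q k ⟨
      (q ∸ k) * s ^ q            ∎

  -- There are g ≥ q²/2 ≥ q h rich lines, so all of them fail with probability at most (1 - 1/q)^(k
  -- g) ≤ 2^(-k h).
  fail-bound : ∀ ps → Unique ps → length ps ≡ 2 * (1 + 2 * s) * q → ∀ h → 2 * h ≤ q →
               ∏ lines (λ L → ∑ choices (fail ps L)) * 2 ^ (k * h) ≤ β ^ length lines
  fail-bound ps u len h 2h≤q = *-cancelʳ-≤ _ _ ((q ^ k) ^ g) {{m^n≢0 (q ^ k) g {{m^n≢0 q k}}}} (begin
    Y * 2 ^ (k * h) * (q ^ k) ^ g        ≡⟨ lemma Y (2 ^ (k * h)) ((q ^ k) ^ g) ⟩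
    Y * (q ^ k) ^ g * 2 ^ (k * h)        ≤⟨ *-monoˡ-≤ (2 ^ (k * h)) total ⟩
    (p ^ k) ^ g * B * 2 ^ (k * h)        ≡⟨ lemma₂ ((p ^ k) ^ g) B _ ⟩
    B * ((p ^ k) ^ g * 2 ^ (k * h))      ≡⟨ cong (B *_) (cong₂ _*_ (swap-exp p) (cong (2 ^_) (*-comm k h))) ⟩
    B * ((p ^ g) ^ k * 2 ^ (h * k))      ≡⟨ cong (λ z → B * ((p ^ g) ^ k * z)) (^-*-assoc 2 h k) ⟨
    B * ((p ^ g) ^ k * (2 ^ h) ^ k)      ≡⟨ cong (B *_) (^-distribʳ-* (p ^ g) (2 ^ h) k) ⟨
    B * (p ^ g * 2 ^ h) ^ k              ≤⟨ *-monoʳ-≤ B (^-monoˡ-≤ k (subst (λ q′ → p ^ g * 2 ^ h ≤ q′ ^ g) (suc-pred q)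
                                              (halving p h g (subst (λ q′ → q′ * h ≤ g) (sym (suc-pred q)) qh≤g)))) ⟩
    B * (q ^ g) ^ k                      ≡⟨ cong (B *_) (swap-exp q) ⟨
    B * (q ^ k) ^ g ∎)
    where
    open ≤-Reasoning
    p = pred q
    g = ∑ lines (λ L → [ s ≤? trace ps L ])
    Y = ∏ lines (λ L → ∑ choices (fail ps L))
    B = β ^ length lines
    lemma : ∀ a b c → a * b * c ≡ a * c * b
    lemma = solve-∀
    lemma₂ : ∀ a b c → a * b * c ≡ b * (a * c)
    lemma₂ = solve-∀
    swap-exp : ∀ x → (x ^ k) ^ g ≡ (x ^ g) ^ k
    swap-exp x = trans (^-*-assoc x k g) (trans (cong (x ^_) (*-comm k g)) (sym (^-*-assoc x g k)))
    qh≤g : q * h ≤ g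
    qh≤g = *-cancelˡ-≤ 2 (begin
      2 * (q * h) ≡⟨ lemma₃ q h ⟩
      q * (2 * h) ≤⟨ *-monoʳ-≤ q 2h≤q ⟩
      q * q       ≤⟨ manyRichLines s ps u len ⟩
      2 * g       ∎)
      where
      lemma₃ : ∀ q h → 2 * (q * h) ≡ q * (2 * h)
      lemma₃ = solve-∀
    total : Y * (q ^ k) ^ g ≤ (p ^ k) ^ g * B
    total = begin
      Y * (q ^ k) ^ g  ≡⟨ cong (Y *_) (∏-^ lines (q ^ k) _) ⟨
      Y * ∏ lines (λ L → (q ^ k) ^ [ s ≤? trace ps L ]) ≡⟨ ∏-* lines _ _ ⟨
      ∏ lines (λ L → ∑ choices (fail ps L) * (q ^ k) ^ [ s ≤? trace ps L ]) ≤⟨ ∏-mono lines (λ L → fail-expectation ps L u) ⟩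
      ∏ lines (λ L → (p ^ k) ^ [ s ≤? trace ps L ] * β) ≡⟨ ∏-* lines _ _ ⟩
      ∏ lines (λ L → (p ^ k) ^ [ s ≤? trace ps L ]) * ∏ lines (λ _ → β) ≡⟨ cong₂ _*_ (∏-^ lines (p ^ k) _) (∏-const lines β) ⟩
      (p ^ k) ^ g * B ∎

-- Cliques

-- Total by means of a default: configurations are enumerated over all tuples of points, including
-- degenerate ones in which a join or an intersection is missing or ambiguous.
search : ∀ {P : A → Set} → (∀ x → Dec (P x)) → List A → A → A
search P? []       x₀ = x₀
search P? (x ∷ xs) x₀ with P? x
... | yes _ = x
... | no _  = search P? xs x₀

search-spec : ∀ {P : A → Set} (P? : ∀ x → Dec (P x)) xs x₀ {x} → x ∈ xs → P x → P (search P? xs x₀)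
search-spec P? (y ∷ xs) x₀ x∈ px with P? y
search-spec P? (y ∷ xs) x₀ x∈          px | yes py = py
search-spec P? (y ∷ xs) x₀ (here refl) px | no ¬py = contradiction px ¬py
search-spec P? (y ∷ xs) x₀ (there x∈)  px | no _   = search-spec P? xs x₀ x∈ px

avoid : DecidableEquality A → ∀ {n} (f : Fin n → A) → (∀ {i j} → f i ≡ f j → i ≡ j) →
        ∀ xs → length xs < n → ∃ λ i → f i ∉ xs
avoid _≟A_ {n} f inj xs lt = Finₚ.¬∀⟶∃¬ n (λ i → f i ∈ xs) (λ i → f i ∈? xs) λ all →
  let i , j , i<j , e = Finₚ.pigeonhole lt (λ i → Any.index (all i)) in
  Finₚ.<⇒≢ i<j (inj (trans (Anyₚ.lookup-index (all i)) (trans (cong (List.lookup xs) e) (sym (Anyₚ.lookup-index (all j))))))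
  where open DecMembership _≟A_ using (_∈?_)

module Configurations {q : ℕ} (Π : Plane q) (P₀ : Plane.Point Π) (L₀ : Plane.Line Π) where
  open Plane Π

  join : Point → Point → Line
  join P Q = search (λ L → (P on? L) ×-dec (Q on? L)) lines L₀

  meet : Line → Line → Point
  meet L M = search (λ P → (P on? L) ×-dec (P on? M)) points P₀

  at : Line → Fin q → Point
  at L x = search (λ P → (P on? L) ×-dec (coord P Fin.≟ x)) points P₀

  join-≡ : ∀ {P Q L} → P ≢ Q → P on L → Q on L → join P Q ≡ L
  join-≡ {P} {Q} {L} P≢Q PL QL =
    let PJ , QJ = search-spec (λ L → (P on? L) ×-dec (Q on? L)) lines L₀ (allLines L) (PL , QL) in
    line-unique P≢Q PJ QJ PL QL

  point-unique : ∀ {P Q L M} → L ≢ M → P on L → P on M → Q on L → Q on M → P ≡ Q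
  point-unique {P} {Q} L≢M PL PM QL QM with P ≟ᴾ Q
  ... | yes e   = e
  ... | no P≢Q = contradiction (line-unique P≢Q PL QL PM QM) L≢M

  meet-≡ : ∀ {P L M} → L ≢ M → P on L → P on M → meet L M ≡ P
  meet-≡ {P} {L} {M} L≢M PL PM =
    let XL , XM = search-spec (λ P → (P on? L) ×-dec (P on? M)) points P₀ (allPoints P) (PL , PM) in
    point-unique L≢M XL XM PL PM

  at-≡ : ∀ {P L} → P on L → at L (coord P) ≡ P
  at-≡ {P} {L} PL =
    let XL , Xc = search-spec (λ Q → (Q on? L) ×-dec (coord Q Fin.≟ coord P)) points P₀ (allPoints P) (PL , refl) in
    coord-injective XL PL Xc

  Config : Set
  Config = Point × List Line

  sides : Point → Point → Point → Point → List Line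
  sides a b c d = join a b ∷ join a c ∷ join a d ∷ join b c ∷ join b d ∷ join c d ∷ []

  -- A quadrangle a b c d with a fifth point e on none of its sides, with a point e on the
  -- side ab only, or with the two diagonal points e and f. The first component is one of
  -- the points of the configuration, to be deleted.
  config₁ : Vec Point 5 → Config
  config₁ (a ∷ b ∷ c ∷ d ∷ e ∷ []) = a , join a e ∷ join c e ∷ join d e ∷ sides a b c d

  config₂ : Vec Point 4 × Fin q → Config
  config₂ ((a ∷ b ∷ c ∷ d ∷ []) , x) = a , join c e ∷ join d e ∷ sides a b c d
    where e = at (join a b) x

  config₃ : Vec Point 4 → Config
  config₃ (a ∷ b ∷ c ∷ d ∷ []) = a , join e f ∷ sides a b c d
    where
    e = meet (join a b) (join c d)
    f = meet (join a c) (join b d)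

  codes₁ = allVecs points 5
  codes₂ = cartesianProduct (allVecs points 4) (allFin q)
  codes₃ = allVecs points 4

  configs : List Config
  configs = map config₁ codes₁ ++ map config₂ codes₂ ++ map config₃ codes₃

  config₁∈ : ∀ v → config₁ v ∈ configs
  config₁∈ v = ∈ₚ.∈-++⁺ˡ (∈ₚ.∈-map⁺ config₁ (∈-allVecs allPoints v))

  config₂∈ : ∀ v x → config₂ (v , x) ∈ configs
  config₂∈ v x = ∈ₚ.∈-++⁺ʳ (map config₁ codes₁) (∈ₚ.∈-++⁺ˡ
    (∈ₚ.∈-map⁺ config₂ (∈ₚ.∈-cartesianProduct⁺ (∈-allVecs allPoints v) (∈ₚ.∈-allFin x))))

  config₃∈ : ∀ v → config₃ v ∈ configs
  config₃∈ v = ∈ₚ.∈-++⁺ʳ (map config₁ codes₁) (∈ₚ.∈-++⁺ʳ (map config₂ codes₂)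
    (∈ₚ.∈-map⁺ config₃ (∈-allVecs allPoints v)))

  module Clique (Sel : Line → Set) (K : Point → Set)
                (link : ∀ {P Q} → K P → K Q → P ≢ Q → ∃ λ L → Sel L × P on L × Q on L) where

    -- The distinguished point has to be a clique point, since its deletion is what destroys the
    -- clique.
    Found : Set
    Found = ∃ λ γ → γ ∈ configs × Unique (proj₂ γ) × All Sel (proj₂ γ) × K (proj₁ γ)

    module _ {P Q} (kP : K P) (kQ : K Q) (P≢Q : P ≢ Q) where

      private
        L   = proj₁ (link kP kQ P≢Q)
        J≡L : join P Q ≡ L
        J≡L = join-≡ P≢Q (proj₁ (proj₂ (proj₂ (link kP kQ P≢Q)))) (proj₂ (proj₂ (proj₂ (link kP kQ P≢Q))))

      join-sel : Sel (join P Q)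
      join-sel = subst Sel (sym J≡L) (proj₁ (proj₂ (link kP kQ P≢Q)))

      joinˡ : P on join P Q
      joinˡ = subst (P on_) (sym J≡L) (proj₁ (proj₂ (proj₂ (link kP kQ P≢Q))))

      joinʳ : Q on join P Q
      joinʳ = subst (Q on_) (sym J≡L) (proj₂ (proj₂ (proj₂ (link kP kQ P≢Q))))

    join-comm : ∀ {P Q} → K P → K Q → P ≢ Q → join P Q ≡ join Q P
    join-comm kP kQ P≢Q = join-≡ P≢Q (joinʳ kQ kP (P≢Q ∘ sym)) (joinˡ kQ kP (P≢Q ∘ sym))

    flip-on : ∀ {P Q R} → K P → K Q → P ≢ Q → R on join P Q → R on join Q P
    flip-on {R = R} kP kQ P≢Q = subst (R on_) (join-comm kP kQ P≢Q)

    flip-off : ∀ {P Q R} → K P → K Q → P ≢ Q → ¬ R on join P Q → ¬ R on join Q P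
    flip-off kP kQ P≢Q off = off ∘ flip-on kQ kP (P≢Q ∘ sym)

    off-swap : ∀ {P Q R} → K P → K Q → K R → P ≢ Q → P ≢ R → ¬ R on join P Q → ¬ Q on join P R
    off-swap {P} {Q} {R} kP kQ kR P≢Q P≢R off Q∈ =
      off (subst (R on_) (sym (join-≡ P≢Q (joinˡ kP kR P≢R) Q∈)) (joinʳ kP kR P≢R))

    separated : ∀ {P L M} → P on L → ¬ P on M → L ≢ M
    separated PL P∉M refl = P∉M PL

    -- A quadrangle, with one non-incidence for each of the four triples; `off-swap` and `flip-off`
    -- yield the others.
    record Generic (a b c d : Point) : Set where
      constructor generic
      field
        ka : K a
        kb : K b
        kc : K c
        kd : K d
        ab : a ≢ b
        ac : a ≢ c
        ad : a ≢ d
        bc : b ≢ c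
        bd : b ≢ d
        cd : c ≢ d
        c∉ab : ¬ c on join a b
        d∉ab : ¬ d on join a b
        d∉ac : ¬ d on join a c
        d∉bc : ¬ d on join b c

    -- The three adjacent transpositions generate all relabellings, so every configuration is
    -- treated in a single labelling.
    swap₁₂ : ∀ {a b c d} → Generic a b c d → Generic b a c d
    swap₁₂ (generic ka kb kc kd ab ac ad bc bd cd c∉ab d∉ab d∉ac d∉bc) =
      generic kb ka kc kd (ab ∘ sym) bc bd ac ad cd (flip-off ka kb ab c∉ab) (flip-off ka kb ab d∉ab) d∉bc d∉ac

    swap₂₃ : ∀ {a b c d} → Generic a b c d → Generic a c b d
    swap₂₃ (generic ka kb kc kd ab ac ad bc bd cd c∉ab d∉ab d∉ac d∉bc) =
      generic ka kc kb kd ac ab ad (bc ∘ sym) cd bd (off-swap ka kb kc ab ac c∉ab) d∉ac d∉ab (flip-off kb kc bc d∉bc)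

    swap₃₄ : ∀ {a b c d} → Generic a b c d → Generic a b d c
    swap₃₄ (generic ka kb kc kd ab ac ad bc bd cd c∉ab d∉ab d∉ac d∉bc) =
      generic ka kb kd kc ab ad ac bd bc (cd ∘ sym) d∉ab c∉ab (off-swap ka kc kd ac ad d∉ac) (off-swap kb kc kd bc bd d∉bc)

    module Sides {a b c d} (G : Generic a b c d) where
      open Generic G public

      b∉ac : ¬ b on join a c
      b∉ac = off-swap ka kb kc ab ac c∉ab
      b∉ad : ¬ b on join a d
      b∉ad = off-swap ka kb kd ab ad d∉ab
      c∉ad : ¬ c on join a d
      c∉ad = off-swap ka kc kd ac ad d∉ac
      c∉bd : ¬ c on join b d
      c∉bd = off-swap kb kc kd bc bd d∉bc
      ab≢cd : join a b ≢ join c d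
      ab≢cd = separated (joinˡ kc kd cd) c∉ab ∘ sym

      uniqueSides : Unique (sides a b c d)
      uniqueSides =
          ((separated (joinʳ ka kc ac) c∉ab ∘ sym) ∷ (separated (joinʳ ka kd ad) d∉ab ∘ sym) ∷
           (separated (joinʳ kb kc bc) c∉ab ∘ sym) ∷ (separated (joinʳ kb kd bd) d∉ab ∘ sym) ∷ ab≢cd ∷ [])
        ∷ ((separated (joinʳ ka kd ad) d∉ac ∘ sym) ∷ (separated (joinˡ kb kc bc) b∉ac ∘ sym) ∷
           (separated (joinˡ kb kd bd) b∉ac ∘ sym) ∷ (separated (joinʳ kc kd cd) d∉ac ∘ sym) ∷ [])
        ∷ ((separated (joinˡ kb kc bc) b∉ad ∘ sym) ∷ (separated (joinˡ kb kd bd) b∉ad ∘ sym) ∷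
           (separated (joinˡ kc kd cd) c∉ad ∘ sym) ∷ [])
        ∷ ((separated (joinʳ kb kd bd) d∉bc ∘ sym) ∷ (separated (joinʳ kc kd cd) d∉bc ∘ sym) ∷ [])
        ∷ ((separated (joinˡ kc kd cd) c∉bd ∘ sym) ∷ [])
        ∷ [] ∷ []

      selectedSides : All Sel (sides a b c d)
      selectedSides = join-sel ka kb ab ∷ join-sel ka kc ac ∷ join-sel ka kd ad ∷
                      join-sel kb kc bc ∷ join-sel kb kd bd ∷ join-sel kc kd cd ∷ []

    Apart : Point → Point → Point → Point → Point → Set
    Apart a b c d e = K e × a ≢ e × b ≢ e × c ≢ e × d ≢ e

    -- A line through `e` is no side, and two joins of `e` to vertices can only coincide if `e` lies
    -- on the side between these. The join of `b` and `e` is left out: nine lines against ten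
    -- degrees of freedom fit the common count.
    offSides⇒Found : ∀ {a b c d e} → Generic a b c d → Apart a b c d e →
      ¬ e on join a b → ¬ e on join a c → ¬ e on join a d →
      ¬ e on join b c → ¬ e on join b d → ¬ e on join c d → Found
    offSides⇒Found {a} {b} {c} {d} {e} G (ke , ae , be , ce , de) n₁ n₂ n₃ n₄ n₅ n₆ =
      config₁ v , config₁∈ v ,
      ((separated (joinˡ kc ke ce) (off-swap ka kc ke ac ae n₂) ∘ sym)
        ∷ (separated (joinˡ kd ke de) (off-swap ka kd ke ad ae n₃) ∘ sym) ∷ fresh (joinʳ ka ke ae))
      ∷ ((separated (joinˡ kd ke de) (off-swap kc kd ke cd ce n₆) ∘ sym) ∷ fresh (joinʳ kc ke ce))
      ∷ fresh (joinʳ kd ke de) ∷ uniqueSides ,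
      join-sel ka ke ae ∷ join-sel kc ke ce ∷ join-sel kd ke de ∷ selectedSides ,
      ka
      where
      open Sides G
      v = a ∷ b ∷ c ∷ d ∷ e ∷ []
      fresh : ∀ {L} → e on L → All (L ≢_) (sides a b c d)
      fresh e∈ = separated e∈ n₁ ∷ separated e∈ n₂ ∷ separated e∈ n₃ ∷
                 separated e∈ n₄ ∷ separated e∈ n₅ ∷ separated e∈ n₆ ∷ []

    -- Sides meeting at `a` or `b` have no second common point, so `e` on `join a b` is off the four
    -- sides adjacent to it. Only the opposite side has to be excluded by hypothesis.
    onOneSide⇒Found : ∀ {a b c d e} → Generic a b c d → Apart a b c d e →
      e on join a b → ¬ e on join c d → Found
    onOneSide⇒Found {a} {b} {c} {d} {e} G (ke , ae , be , ce , de) e∈ab e∉cd =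
      config₂ (v , coord e) , config₂∈ v (coord e) ,
      subst (λ x → Unique (join c x ∷ join d x ∷ sides a b c d)) (sym (at-≡ e∈ab))
        (((separated (joinˡ kd ke de) (off-swap kc kd ke cd ce e∉cd) ∘ sym) ∷ fresh (joinʳ kc ke ce) (separated (joinˡ kc ke ce) c∉ab))
        ∷ fresh (joinʳ kd ke de) (separated (joinˡ kd ke de) d∉ab) ∷ uniqueSides) ,
      subst (λ x → All Sel (join c x ∷ join d x ∷ sides a b c d)) (sym (at-≡ e∈ab))
        (join-sel kc ke ce ∷ join-sel kd ke de ∷ selectedSides) ,
      ka
      where
      open Sides G
      v = a ∷ b ∷ c ∷ d ∷ []
      fresh : ∀ {L} → e on L → L ≢ join a b → All (L ≢_) (sides a b c d)
      fresh e∈ L≢ab = L≢ab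
        ∷ separated e∈ (λ h → b∉ac (subst (b on_) (line-unique ae (joinˡ ka kb ab) e∈ab (joinˡ ka kc ac) h) (joinʳ ka kb ab)))
        ∷ separated e∈ (λ h → b∉ad (subst (b on_) (line-unique ae (joinˡ ka kb ab) e∈ab (joinˡ ka kd ad) h) (joinʳ ka kb ab)))
        ∷ separated e∈ (λ h → c∉ab (subst (c on_) (line-unique be (joinˡ kb kc bc) h (joinʳ ka kb ab) e∈ab) (joinʳ kb kc bc)))
        ∷ separated e∈ (λ h → d∉ab (subst (d on_) (line-unique be (joinˡ kb kd bd) h (joinʳ ka kb ab) e∈ab) (joinʳ kb kd bd)))
        ∷ separated e∈ e∉cd ∷ []

    -- Each side misses `e` or `f`, because adjacent sides share only their vertex; so `join e f` is
    -- a seventh line.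
    diagonals⇒Found : ∀ {a b c d e f} → Generic a b c d → Apart a b c d e → Apart a b c d f → e ≢ f →
      e on join a b → e on join c d → f on join a c → f on join b d → Found
    diagonals⇒Found {a} {b} {c} {d} {e} {f} G (ke , ae , be , ce , de) (kf , af , bf , cf , df) ef e∈ab e∈cd f∈ac f∈bd =
      config₃ v , config₃∈ v ,
      subst₂ (λ x y → Unique (join x y ∷ sides a b c d)) (sym e≡) (sym f≡) (fresh ∷ uniqueSides) ,
      subst₂ (λ x y → All Sel (join x y ∷ sides a b c d)) (sym e≡) (sym f≡) (join-sel ke kf ef ∷ selectedSides) ,
      ka
      where
      open Sides G
      v = a ∷ b ∷ c ∷ d ∷ []
      e≡ = meet-≡ ab≢cd e∈ab e∈cd
      f≡ = meet-≡ (separated (joinˡ kb kd bd) b∉ac ∘ sym) f∈ac f∈bd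
      e∈ef = joinˡ ke kf ef
      f∈ef = joinʳ ke kf ef
      fresh : All (join e f ≢_) (sides a b c d)
      fresh = separated f∈ef (λ h → b∉ac (subst (b on_) (line-unique af (joinˡ ka kb ab) h (joinˡ ka kc ac) f∈ac) (joinʳ ka kb ab)))
        ∷ separated e∈ef (λ h → b∉ac (subst (b on_) (line-unique ae (joinˡ ka kb ab) e∈ab (joinˡ ka kc ac) h) (joinʳ ka kb ab)))
        ∷ separated e∈ef (λ h → b∉ad (subst (b on_) (line-unique ae (joinˡ ka kb ab) e∈ab (joinˡ ka kd ad) h) (joinʳ ka kb ab)))
        ∷ separated e∈ef (λ h → c∉ab (subst (c on_) (line-unique be (joinˡ kb kc bc) h (joinʳ ka kb ab) e∈ab) (joinʳ kb kc bc)))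
        ∷ separated e∈ef (λ h → d∉ab (subst (d on_) (line-unique be (joinˡ kb kd bd) h (joinʳ ka kb ab) e∈ab) (joinʳ kb kd bd)))
        ∷ separated f∈ef (λ h → d∉ac (subst (d on_) (line-unique cf (joinˡ kc kd cd) h (joinʳ ka kc ac) f∈ac) (joinʳ kc kd cd)))
        ∷ []

    data Diagonal (a b c d e : Point) : Set where
      ab∩cd : e on join a b → e on join c d → Diagonal a b c d e
      ac∩bd : e on join a c → e on join b d → Diagonal a b c d e
      ad∩bc : e on join a d → e on join b c → Diagonal a b c d e

    -- Away from the vertices only opposite sides can meet, hence the tests in three opposite pairs.
    classify : ∀ {a b c d e} → Generic a b c d → Apart a b c d e → Found ⊎ Diagonal a b c d e
    classify {a} {b} {c} {d} {e} G E@(ke , ae , be , ce , de)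
      with e on? join a b | e on? join c d | e on? join a c | e on? join b d | e on? join a d | e on? join b c
    ... | yes p | yes p′ | _ | _ | _ | _ = inj₂ (ab∩cd p p′)
    ... | _ | _ | yes p | yes p′ | _ | _ = inj₂ (ac∩bd p p′)
    ... | _ | _ | _ | _ | yes p | yes p′ = inj₂ (ad∩bc p p′)
    ... | yes p | no n | _ | _ | _ | _ = inj₁ (onOneSide⇒Found G E p n)
    ... | no n | yes p | _ | _ | _ | _ =
          -- The four transpositions turn a b c d into c d a b, which brings the side containing `e`
          -- to the front.
          inj₁ (onOneSide⇒Found (swap₂₃ (swap₁₂ (swap₃₄ (swap₂₃ G)))) (ke , ce , de , ae , be) p n)
    ... | _ | _ | yes p | no n | _ | _ = inj₁ (onOneSide⇒Found (swap₂₃ G) (ke , ae , ce , be , de) p n)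
    ... | _ | _ | no n | yes p | _ | _ =
          inj₁ (onOneSide⇒Found (swap₂₃ (swap₁₂ (swap₃₄ G))) (ke , be , de , ae , ce) p n)
    ... | _ | _ | _ | _ | yes p | no n = inj₁ (onOneSide⇒Found (swap₂₃ (swap₃₄ G)) (ke , ae , de , be , ce) p n)
    ... | _ | _ | _ | _ | no n | yes p = inj₁ (onOneSide⇒Found (swap₂₃ (swap₁₂ G)) (ke , be , ce , ae , de) p n)
    ... | no n₁ | no n₆ | no n₂ | no n₅ | no n₃ | no n₄ = inj₁ (offSides⇒Found G E n₁ n₂ n₃ n₄ n₅ n₆)

    -- Opposite sides meet in at most one point, so two distinct diagonal points belong to different
    -- pairs of opposite sides; relabelling turns these into the first two pairs.
    sixPoints⇒Found : ∀ {a b c d e f} → Generic a b c d → Apart a b c d e → Apart a b c d f → e ≢ f → Found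
    sixPoints⇒Found {a} {b} {c} {d} {e} {f} G E@(ke , ae , be , ce , de) F@(kf , af , bf , cf , df) ef
      with classify G E | classify G F
    ... | inj₁ x | _ = x
    ... | _ | inj₁ x = x
    ... | inj₂ δ | inj₂ ε = go δ ε
      where
      open Sides G
      go : Diagonal a b c d e → Diagonal a b c d f → Found
      go (ab∩cd x y) (ab∩cd z w) = contradiction (point-unique ab≢cd x y z w) ef
      go (ac∩bd x y) (ac∩bd z w) = contradiction (point-unique (separated (joinˡ kb kd bd) b∉ac ∘ sym) x y z w) ef
      go (ad∩bc x y) (ad∩bc z w) = contradiction (point-unique (separated (joinˡ kb kc bc) b∉ad ∘ sym) x y z w) ef
      go (ab∩cd x y) (ac∩bd z w) = diagonals⇒Found G E F ef x y z w
      go (ab∩cd x y) (ad∩bc z w) = diagonals⇒Found (swap₃₄ G) (ke , ae , be , de , ce) (kf , af , bf , df , cf) ef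
        x (flip-on kc kd cd y) z w
      go (ac∩bd x y) (ab∩cd z w) = diagonals⇒Found (swap₂₃ G) (ke , ae , ce , be , de) (kf , af , cf , bf , df) ef x y z w
      go (ac∩bd x y) (ad∩bc z w) = diagonals⇒Found (swap₃₄ (swap₂₃ G)) (ke , ae , ce , de , be) (kf , af , cf , df , bf) ef
        x (flip-on kb kd bd y) z (flip-on kb kc bc w)
      go (ad∩bc x y) (ab∩cd z w) = diagonals⇒Found (swap₂₃ (swap₃₄ G)) (ke , ae , de , be , ce) (kf , af , df , bf , cf) ef
        x y z (flip-on kc kd cd w)
      go (ad∩bc x y) (ac∩bd z w) = diagonals⇒Found (swap₃₄ (swap₂₃ (swap₃₄ G))) (ke , ae , de , ce , be) (kf , af , df , cf , bf) ef
        x (flip-on kb kc bc y) z (flip-on kb kd bd w)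

    generic-off : ∀ {u v y z M} → K u → K v → K y → K z → u ≢ v → y ≢ z → u on M → v on M → ¬ y on M → ¬ z on M →
                  ¬ u on join y z → ¬ v on join y z → Generic u v y z
    generic-off {u} {v} {y} {z} {M} ku kv ky kz uv yz uM vM y∉M z∉M u∉ v∉ =
      generic ku kv ky kz uv (away uM y∉M) (away uM z∉M) (away vM y∉M) (away vM z∉M) yz
        (subst (λ L → ¬ y on L) (sym J) y∉M) (subst (λ L → ¬ z on L) (sym J) z∉M)
        (off-swap′ ku (away uM y∉M) u∉) (off-swap′ kv (away vM y∉M) v∉)
      where
      J = join-≡ uv uM vM
      away : ∀ {p r} → p on M → ¬ r on M → p ≢ r
      away pM r∉M refl = r∉M pM
      off-swap′ : ∀ {p} → K p → p ≢ y → ¬ p on join y z → ¬ z on join p y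
      off-swap′ kp py p∉ = flip-off ky kp (py ∘ sym) (off-swap ky kz kp yz (py ∘ sym) p∉)

    -- The line through `y` and `z` contains at most one of the three points on `M`; the other two
    -- complete the quadrangle.
    generic-3+2 : ∀ {u v w y z M} → K u → K v → K w → K y → K z → u ≢ v → u ≢ w → v ≢ w → y ≢ z →
      u on M → v on M → w on M → ¬ y on M → ¬ z on M →
      ∃ λ a → ∃ λ b → Generic a b y z
    generic-3+2 {u} {v} {w} {y} {z} {M} ku kv kw ky kz uv uw vw yz uM vM wM y∉M z∉M
      with u on? join y z | v on? join y z
    ... | yes u∈ | _ = v , w , generic-off kv kw ky kz vw yz vM wM y∉M z∉M (other uv u∈ uM vM) (other uw u∈ uM wM)
      where
      other : ∀ {p r} → p ≢ r → p on join y z → p on M → r on M → ¬ r on join y z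
      other pr p∈ pM rM r∈ = y∉M (subst (y on_) (line-unique pr p∈ r∈ pM rM) (joinˡ ky kz yz))
    ... | no u∉ | no v∉ = u , v , generic-off ku kv ky kz uv yz uM vM y∉M z∉M u∉ v∉
    ... | no u∉ | yes v∈ = u , w , generic-off ku kw ky kz uw yz uM wM y∉M z∉M u∉
            λ w∈ → y∉M (subst (y on_) (line-unique vw v∈ w∈ vM wM) (joinˡ ky kz yz))

    -- All that the colours contribute to the search for a quadrangle: no line carries more than s
    -- of the s + 2 clique points.
    TwoOff : Set
    TwoOff = ∀ L → ∃ λ y → ∃ λ z → K y × K z × y ≢ z × ¬ y on L × ¬ z on L

    -- Take two clique points `x`, `y` off the line `a b`. If the line `x y` passes through `a` or
    -- `b`, it carries three clique points, and two more off it give the situation of `generic-3+2`.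
    ∃generic : TwoOff → ∀ {a b} → K a → K b → a ≢ b → ∃ λ a → ∃ λ b → ∃ λ c → ∃ λ d → Generic a b c d
    ∃generic twoOff {a} {b} ka kb ab with twoOff (join a b)
    ... | x , y , kx , ky , xy , x∉ , y∉ with a on? join x y | b on? join x y
    ...   | no a∉ | no b∉ = a , b , x , y , generic-off ka kb kx ky ab xy (joinˡ ka kb ab) (joinʳ ka kb ab) x∉ y∉ a∉ b∉
    ...   | yes a∈ | _ = let u , v , ku , kv , uv , u∉ , v∉ = twoOff (join x y)
                             c , d , G = generic-3+2 ka kx ky ku kv (away (joinˡ ka kb ab) x∉) (away (joinˡ ka kb ab) y∉) xy uv
                                           a∈ (joinˡ kx ky xy) (joinʳ kx ky xy) u∉ v∉
                         in c , d , u , v , G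
      where
      away : ∀ {p r M} → p on M → ¬ r on M → p ≢ r
      away pM r∉M refl = r∉M pM
    ...   | no _ | yes b∈ = let u , v , ku , kv , uv , u∉ , v∉ = twoOff (join x y)
                                c , d , G = generic-3+2 kb kx ky ku kv (away (joinʳ ka kb ab) x∉) (away (joinʳ ka kb ab) y∉) xy uv
                                              b∈ (joinˡ kx ky xy) (joinʳ kx ky xy) u∉ v∉
                            in c , d , u , v , G
      where
      away : ∀ {p r M} → p on M → ¬ r on M → p ≢ r
      away pM r∉M refl = r∉M pM

  clique⇒config : ∀ {s} → 4 ≤ s → (Sel : Line → Set) (colour : Line → Point → Fin s) (f : Fin (2 + s) → Point) →
    (∀ {i j} → i ≢ j → f i ≢ f j × ∃ λ L → Sel L × f i on L × f j on L × colour L (f i) ≢ colour L (f j)) →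
    ∃ λ γ → γ ∈ configs × Unique (proj₂ γ) × All Sel (proj₂ γ) × ∃ λ i → f i ≡ proj₁ γ
  clique⇒config {s} 4≤s Sel colour f adj =
    let a , b , c , d , G = ∃generic twoOff (zero , refl) (suc zero , refl) (proj₁ (adj λ ()))
        open Generic G
        i , i∉ = avoid _≟ᴾ_ f f-inj (a ∷ b ∷ c ∷ d ∷ []) (s≤s (≤-trans 4≤s (n≤1+n s)))
        -- Five points are to be avoided among s + 2, which takes s ≥ 4.
        j , j∉ = avoid _≟ᴾ_ f f-inj (a ∷ b ∷ c ∷ d ∷ f i ∷ []) (s≤s (s≤s 4≤s))
    in sixPoints⇒Found G ((i , refl) , (i∉ ∘ here ∘ sym) , (i∉ ∘ there ∘ here ∘ sym) ,
           (i∉ ∘ there ∘ there ∘ here ∘ sym) , (i∉ ∘ there ∘ there ∘ there ∘ here ∘ sym))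
         ((j , refl) , (j∉ ∘ here ∘ sym) , (j∉ ∘ there ∘ here ∘ sym) ,
           (j∉ ∘ there ∘ there ∘ here ∘ sym) , (j∉ ∘ there ∘ there ∘ there ∘ here ∘ sym))
         (j∉ ∘ there ∘ there ∘ there ∘ there ∘ here ∘ sym)
    where
    K : Point → Set
    K P = ∃ λ i → f i ≡ P
    f-inj : ∀ {i j} → f i ≡ f j → i ≡ j
    f-inj {i} {j} e with i Fin.≟ j
    ... | yes i≡j = i≡j
    ... | no i≢j = contradiction e (proj₁ (adj i≢j))
    link : ∀ {P Q} → K P → K Q → P ≢ Q → ∃ λ L → Sel L × P on L × Q on L
    link (i , refl) (j , refl) P≢Q =
      let _ , L , sel , PL , QL , _ = adj (λ i≡j → P≢Q (cong f i≡j)) in L , sel , PL , QL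
    open Clique Sel K link
    -- Adjacent points differ in colour on the line that joins them, and this can only be `L`.
    colour-inj : ∀ L {i j} → i ≢ j → f i on L → f j on L → colour L (f i) ≢ colour L (f j)
    colour-inj L i≢j iL jL e with adj i≢j
    ... | fi≢fj , M , _ , iM , jM , c≢ with line-unique fi≢fj iL jL iM jM
    ...   | refl = c≢ e
    offLine : ∀ L → ∃ λ i → ¬ f i on L
    offLine L = Finₚ.¬∀⟶∃¬ _ (λ i → f i on L) (λ i → f i on? L) λ all →
      let i , j , i<j , e = Finₚ.pigeonhole (m≤n⇒m≤1+n ≤-refl) (λ i → colour L (f i)) in
      colour-inj L (Finₚ.<⇒≢ i<j) (all i) (all j) e
    twoOff : TwoOff
    twoOff L =
      -- With one point off `L` set aside by `punchIn`, s + 1 points remain, still more than there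
      -- are colours.
      let i , i∉ = offLine L
          j , j∉ = Finₚ.¬∀⟶∃¬ _ (λ j → f (Fin.punchIn i j) on L) (λ j → f (Fin.punchIn i j) on? L) λ all →
            let j , k , j<k , e = Finₚ.pigeonhole ≤-refl (λ j → colour L (f (Fin.punchIn i j))) in
            colour-inj L (Finₚ.<⇒≢ j<k ∘ Finₚ.punchIn-injective i j k) (all j) (all k) e
      in f i , f (Fin.punchIn i j) , (i , refl) , (_ , refl) , (λ e → Finₚ.punchInᵢ≢i i j (sym (f-inj e))) , i∉ , j∉

-- Deleting a point of each selected configuration

length-filter≡∑ : ∀ {P : A → Set} (P? : ∀ x → Dec (P x)) xs → length (filter P? xs) ≡ ∑ xs (λ x → [ P? x ])
length-filter≡∑ P? []       = refl
length-filter≡∑ P? (x ∷ xs) with P? x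
... | yes _ = cong suc (length-filter≡∑ P? xs)
... | no _  = length-filter≡∑ P? xs

list⇒vec : ∀ (xs : List A) {n} → length xs ≡ n → ∃ λ (v : Vec A n) → Vec.toList v ≡ xs
list⇒vec xs refl = Vec.fromList xs , Vecₚ.toList∘fromList xs

elements : ∀ {n} → Subset n → List (Fin n)
elements []           = []
elements (true  ∷ W) = zero ∷ map suc (elements W)
elements (false ∷ W) = map suc (elements W)

length-elements : ∀ {n} (W : Subset n) → length (elements W) ≡ ∣ W ∣
length-elements []          = refl
length-elements (true  ∷ W) = cong suc (trans (Listₚ.length-map suc (elements W)) (length-elements W))
length-elements (false ∷ W) = trans (Listₚ.length-map suc (elements W)) (length-elements W)

elements⊆ : ∀ {n} (W : Subset n) {i} → i ∈ elements W → i Subset.∈ W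
elements⊆ (true  ∷ W) (here refl) = Vec.here
elements⊆ (true  ∷ W) (there i∈) with ∈ₚ.∈-map⁻ suc i∈
... | j , j∈ , refl = Vec.there (elements⊆ W j∈)
elements⊆ (false ∷ W) i∈ with ∈ₚ.∈-map⁻ suc i∈
... | j , j∈ , refl = Vec.there (elements⊆ W j∈)

elements-unique : ∀ {n} (W : Subset n) → Unique (elements W)
elements-unique []          = []
elements-unique (true  ∷ W) = All.tabulate (λ i∈ e → case ∈ₚ.∈-map⁻ suc i∈ of λ { (j , _ , refl) → case e of λ () })
                              ∷ Uniqueₚ.map⁺ Finₚ.suc-injective (elements-unique W)
elements-unique (false ∷ W) = Uniqueₚ.map⁺ Finₚ.suc-injective (elements-unique W)

fromDoes : (d : Dec A) → does d ≡ true → A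
fromDoes (yes a) _ = a

does-cong : ∀ {B : Set} (d : Dec A) (e : Dec B) → (A → B) → (B → A) → does d ≡ does e
does-cong (yes a) e f g = sym (dec-true e (f a))
does-cong (no ¬a) e f g = sym (dec-false e (¬a ∘ g))

greedy : DecidableEquality A → ∀ {xs : List A} → Unique xs → ∀ bs n → n + length bs ≤ length xs →
         ∃ λ ys → length ys ≡ n × Unique ys × (∀ {y} → y ∈ ys → y ∉ bs)
greedy _≟A_ u bs zero    _  = [] , refl , [] , λ ()
greedy _≟A_ {xs} u bs (suc n) le with greedy _≟A_ u bs n (<⇒≤ le)
... | ys , refl , uys , off = let i , i∉ = avoid _≟A_ (List.lookup xs) (lookup-injective u) (ys ++ bs)
                                    (subst (_< length xs) (sym (Listₚ.length-++ ys)) le) in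
      List.lookup xs i ∷ ys , refl , All.tabulate (λ y∈ e → i∉ (∈ₚ.∈-++⁺ˡ (subst (_∈ ys) (sym e) y∈))) ∷ uys ,
      λ { (here refl) → i∉ ∘ ∈ₚ.∈-++⁺ʳ ys ; (there y∈) → off y∈ }

tupleSize : ℕ → ℕ → ℕ
tupleSize s q = 2 * (1 + 2 * s) * q

-- The budget of the weighted count: 1 for all tuples together and q b^r for each family of
-- configurations with r lines.
badBound : ℕ → ℕ → ℕ
badBound q b = 1 + q * (b ^ 9 + b ^ 8 + b ^ 7)

module Construction (s q k : ℕ) .{{_ : NonZero s}} .{{_ : NonZero q}} (Π : Plane q) (b≤q : k * s ^ s ≤ q)
  (P₀ : Plane.Point Π) (L₀ : Plane.Line Π)
  (h : ℕ) (2h≤q : 2 * h ≤ q)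
  (unionBound : (q * q) ^ tupleSize s q * (q * q) ≤ 2 ^ (k * h))
  (fewBad : 2 * badBound q (k * s ^ s) ≤ q * q) where

  open Plane Π
  open Random s q k Π b≤q
  open SecondMoment Π
  open Configurations Π P₀ L₀

  w R : ℕ
  w = tupleSize s q
  R = badBound q b

  tuples : List (Vec Point w)
  tuples = allVecs points w

  events : List (Vec Point w ⊎ Config)
  events = map inj₁ tuples ++ map inj₂ configs

  -- A failing tuple weighs `q * q`, more than the whole budget `R`, so no tuple can fail;
  -- configurations weigh 1 and are merely counted. Tuples with repeated points and configurations
  -- with repeated lines get weight 0, as the expectation bounds require distinctness.
  weight : Vec Point w ⊎ Config → ℕ
  weight (inj₁ T) = [ unique? _≟ᴾ_ (Vec.toList T) ] * (q * q)
  weight (inj₂ γ) = [ unique? _≟ᴸ_ (proj₂ γ) ]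

  cost : Vec Point w ⊎ Config → Line → Choice → ℕ
  cost (inj₁ T) = fail (Vec.toList T)
  cost (inj₂ γ) = selCost (proj₂ γ)

  B : ℕ
  B = β ^ length lines

  instance
    B≢0 : NonZero B
    B≢0 = m^n≢0 β (length lines) {{β≢0}}

  expected : Vec Point w ⊎ Config → ℕ
  expected e = weight e * ∏ lines (λ L → ∑ choices (cost e L))

  tuples-bound : ∑ tuples (expected ∘ inj₁) ≤ B
  tuples-bound = *-cancelʳ-≤ _ _ (2 ^ (k * h)) {{m^n≢0 2 (k * h)}} (begin
    ∑ tuples (expected ∘ inj₁) * 2 ^ (k * h)          ≡⟨ ∑-*ʳ tuples _ _ ⟨
    ∑ tuples (λ T → expected (inj₁ T) * 2 ^ (k * h))  ≤⟨ ∑-mono tuples each ⟩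
    ∑ tuples (λ _ → q * q * B)                        ≡⟨ ∑-const tuples _ ⟩
    length tuples * (q * q * B)                       ≡⟨ cong (_* (q * q * B)) (trans (length-allVecs points w) (cong (_^ w) #points)) ⟩
    (q * q) ^ w * (q * q * B)                         ≡⟨ *-assoc ((q * q) ^ w) (q * q) B ⟨
    (q * q) ^ w * (q * q) * B                         ≤⟨ *-monoˡ-≤ B unionBound ⟩
    2 ^ (k * h) * B                                   ≡⟨ *-comm (2 ^ (k * h)) B ⟩
    B * 2 ^ (k * h) ∎)
    where
    open ≤-Reasoning
    each : ∀ T → expected (inj₁ T) * 2 ^ (k * h) ≤ q * q * B
    each T with unique? _≟ᴾ_ (Vec.toList T)
    ... | no _  = z≤n
    ... | yes u = begin
      1 * (q * q) * Y * 2 ^ (k * h)    ≡⟨ cong (λ z → z * Y * 2 ^ (k * h)) (*-identityˡ (q * q)) ⟩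
      q * q * Y * 2 ^ (k * h)          ≡⟨ *-assoc (q * q) Y _ ⟩
      q * q * (Y * 2 ^ (k * h))        ≤⟨ *-monoʳ-≤ (q * q) (fail-bound (Vec.toList T) u (Vecₚ.length-toList T) h 2h≤q) ⟩
      q * q * B ∎
      where
      Y = ∏ lines (λ L → ∑ choices (fail (Vec.toList T) L))

  -- q^(r+1) codes, each selected with probability at most (b/q)^r once degenerate ones are
  -- discarded; `B` is the common denominator.
  family-bound : ∀ {V : Set} (codes : List V) (config : V → Config) r → length codes ≡ q ^ suc r →
                 (∀ v → length (proj₂ (config v)) ≡ r) →
                 ∑ codes (λ v → expected (inj₂ (config v))) ≤ q * b ^ r * B
  family-bound codes config r #codes #lines = *-cancelʳ-≤ _ _ (q ^ r) {{m^n≢0 q r}} (begin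
    ∑ codes (λ v → expected (inj₂ (config v))) * q ^ r    ≡⟨ ∑-*ʳ codes _ _ ⟨
    ∑ codes (λ v → expected (inj₂ (config v)) * q ^ r)    ≤⟨ ∑-mono codes each ⟩
    ∑ codes (λ _ → b ^ r * B)                             ≡⟨ ∑-const codes _ ⟩
    length codes * (b ^ r * B)                            ≡⟨ cong (_* (b ^ r * B)) #codes ⟩
    q * q ^ r * (b ^ r * B)                               ≡⟨ lemma q (q ^ r) (b ^ r) B ⟩
    q * b ^ r * B * q ^ r ∎)
    where
    open ≤-Reasoning
    lemma : ∀ q x y z → q * x * (y * z) ≡ q * y * z * x
    lemma = solve-∀
    each : ∀ v → expected (inj₂ (config v)) * q ^ r ≤ b ^ r * B
    each v with unique? _≟ᴸ_ (proj₂ (config v))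
    ... | no _  = z≤n
    ... | yes u = ≤-reflexive (trans (cong (_* q ^ r) (*-identityˡ X))
            (subst (λ r → X * q ^ r ≡ b ^ r * B) (#lines v) (selCost-expectation (proj₂ (config v)) u)))
      where
      X = ∏ lines (λ L → ∑ choices (selCost (proj₂ (config v)) L))

  configs-bound : ∑ configs (expected ∘ inj₂) ≤ q * (b ^ 9 + b ^ 8 + b ^ 7) * B
  configs-bound = begin
    ∑ configs (expected ∘ inj₂)
      ≡⟨ trans (∑-++ (map config₁ codes₁) _ _)
           (cong (∑ (map config₁ codes₁) (expected ∘ inj₂) +_) (∑-++ (map config₂ codes₂) _ _)) ⟩
    ∑ (map config₁ codes₁) (expected ∘ inj₂) +
      (∑ (map config₂ codes₂) (expected ∘ inj₂) + ∑ (map config₃ codes₃) (expected ∘ inj₂))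
      ≡⟨ cong₂ _+_ (∑-map codes₁ config₁ _) (cong₂ _+_ (∑-map codes₂ config₂ _) (∑-map codes₃ config₃ _)) ⟩
    ∑ codes₁ (expected ∘ inj₂ ∘ config₁) +
      (∑ codes₂ (expected ∘ inj₂ ∘ config₂) + ∑ codes₃ (expected ∘ inj₂ ∘ config₃))
      ≤⟨ +-mono-≤ (family-bound codes₁ config₁ 9 #codes₁ λ { (_ ∷ _ ∷ _ ∷ _ ∷ _ ∷ []) → refl })
          (+-mono-≤ (family-bound codes₂ config₂ 8 #codes₂ λ { ((_ ∷ _ ∷ _ ∷ _ ∷ []) , _) → refl })
                    (family-bound codes₃ config₃ 7 #codes₃ λ { (_ ∷ _ ∷ _ ∷ _ ∷ []) → refl })) ⟩
    q * b ^ 9 * B + (q * b ^ 8 * B + q * b ^ 7 * B) ≡⟨ lemma q (b ^ 9) (b ^ 8) (b ^ 7) B ⟩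
    q * (b ^ 9 + b ^ 8 + b ^ 7) * B ∎
    where
    open ≤-Reasoning
    lemma : ∀ q x y z B → q * x * B + (q * y * B + q * z * B) ≡ q * (x + y + z) * B
    lemma = solve-∀
    #vecs : ∀ n → length (allVecs points n) ≡ q ^ (2 * n)
    #vecs n = trans (length-allVecs points n) (trans (cong (_^ n) (trans #points (cong (q *_) (sym (*-identityʳ q))))) (^-*-assoc q 2 n))
    #codes₁ : length codes₁ ≡ q ^ 10
    #codes₁ = #vecs 5
    #codes₂ : length codes₂ ≡ q ^ 9
    #codes₂ = trans (length-× _,_ (allVecs points 4) (allFin q)) (trans (cong₂ _*_ (#vecs 4) (length-allFin q)) (*-comm (q ^ 8) q))
    #codes₃ : length codes₃ ≡ q ^ 8
    #codes₃ = #vecs 4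

  abstract
    outcome : ∃ λ (ω : Line → Choice) → ∑ events (λ e → weight e * ∏ lines (λ L → cost e L (ω L))) * length choices ^ length lines
                                        ≤ ∑ events expected
    outcome = average _≟ᴸ_ lines uniqueLines choices
                (subst (1 ≤_) (sym #choices) (>-nonZero⁻¹ β {{β≢0}})) events weight cost

  ω : Line → Choice
  ω = proj₁ outcome

  actual : Vec Point w ⊎ Config → ℕ
  actual e = weight e * ∏ lines (λ L → cost e L (ω L))

  actual≤R : ∑ tuples (actual ∘ inj₁) + ∑ configs (actual ∘ inj₂) ≤ R
  actual≤R = *-cancelʳ-≤ _ _ B (begin
    (∑ tuples (actual ∘ inj₁) + ∑ configs (actual ∘ inj₂)) * B  ≡⟨ cong (_* B) (split actual) ⟨
    ∑ events actual * B                                         ≡⟨ cong (λ z → ∑ events actual * z ^ length lines) #choices ⟨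
    ∑ events actual * length choices ^ length lines             ≤⟨ proj₂ outcome ⟩
    ∑ events expected                                           ≡⟨ split expected ⟩
    ∑ tuples (expected ∘ inj₁) + ∑ configs (expected ∘ inj₂)    ≤⟨ +-mono-≤ tuples-bound configs-bound ⟩
    B + q * (b ^ 9 + b ^ 8 + b ^ 7) * B                         ∎)
    where
    open ≤-Reasoning
    split : ∀ f → ∑ events f ≡ ∑ tuples (f ∘ inj₁) + ∑ configs (f ∘ inj₂)
    split f = trans (∑-++ (map inj₁ tuples) _ f) (cong₂ _+_ (∑-map tuples inj₁ f) (∑-map configs inj₂ f))

  Sel : Line → Set
  Sel L = proj₁ (ω L) ≡ true

  Sel? : ∀ L → Dec (Sel L)
  Sel? L = proj₁ (ω L) Boolₚ.≟ true

  colour : Line → Point → Fin s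
  colour L P = Vec.lookup (proj₂ (ω L)) (coord P)

  -- An integer product `Y` with q² Y ≤ R < q² is zero, so one of its factors vanishes: some line
  -- succeeds.
  tuple-rainbow : ∀ ps → Unique ps → length ps ≡ w → ∃ λ L → Sel L × ∃ λ (v : Fin s → Point) →
                  ∀ j → v j ∈ ps × v j on L × colour L (v j) ≡ j
  tuple-rainbow ps u len with list⇒vec ps len
  ... | T , refl =
    let L , _ , fail≡ = ∏≡0 lines (λ L → fail ps L (ω L)) vanish
        rich , sel , col = fail≡0 ps L (ω L) fail≡
    in L , sel , pick ps L rich , λ j → proj₁ (pick-on ps L rich j) , proj₂ (pick-on ps L rich j) , col j
    where
    open ≤-Reasoning
    Y = ∏ lines (λ L → fail ps L (ω L))
    small : q * q * Y < q * q * 1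
    small = begin-strict
      q * q * Y            ≡⟨ cong (_* Y) (trans (cong (_* (q * q)) ([]-yes (unique? _≟ᴾ_ ps) u)) (*-identityˡ (q * q))) ⟨
      actual (inj₁ T)      ≤⟨ ∑-term tuples (actual ∘ inj₁) (∈-allVecs allPoints T) ⟩
      ∑ tuples (actual ∘ inj₁) ≤⟨ ≤-trans (m≤m+n _ _) actual≤R ⟩
      R                    <⟨ m<m+n R (s≤s z≤n) ⟩
      2 * R                ≤⟨ fewBad ⟩
      q * q                ≡⟨ *-identityʳ (q * q) ⟨
      q * q * 1            ∎
    vanish : Y ≡ 0
    vanish = n<1⇒n≡0 (*-cancelˡ-< (q * q) Y 1 small)

  Bad : Config → Set
  Bad γ = Unique (proj₂ γ) × All Sel (proj₂ γ)

  Bad? : ∀ γ → Dec (Bad γ)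
  Bad? γ = unique? _≟ᴸ_ (proj₂ γ) ×-dec All.all? Sel? (proj₂ γ)

  deleted : List Point
  deleted = map proj₁ (filter Bad? configs)

  deleted∋ : ∀ {γ} → γ ∈ configs → Bad γ → proj₁ γ ∈ deleted
  deleted∋ γ∈ bad = ∈ₚ.∈-map⁺ proj₁ (∈ₚ.∈-filter⁺ Bad? γ∈ bad)

  #deleted : length deleted ≤ R
  #deleted = begin
    length deleted                ≡⟨ trans (Listₚ.length-map proj₁ (filter Bad? configs)) (length-filter≡∑ Bad? configs) ⟩
    ∑ configs (λ γ → [ Bad? γ ])  ≤⟨ ∑-mono configs each ⟩
    ∑ configs (actual ∘ inj₂)     ≤⟨ ≤-trans (m≤n+m _ (∑ tuples (actual ∘ inj₁))) actual≤R ⟩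
    R                             ∎
    where
    open ≤-Reasoning
    each : ∀ γ → [ Bad? γ ] ≤ actual (inj₂ γ)
    each γ with unique? _≟ᴸ_ (proj₂ γ) | All.all? Sel? (proj₂ γ)
    ... | no _  | _       = z≤n
    ... | yes _ | no _    = z≤n
    ... | yes _ | yes sel = ≤-reflexive (sym (trans (*-identityˡ _)
            (∏-one lines λ L _ → selCost≡1 (proj₂ γ) L (ω L) (All.lookup sel))))

  Edge : Point → Point → Set
  Edge P Q = Any (λ L → Sel L × P on L × Q on L × colour L P ≢ colour L Q) lines

  edge? : ∀ P Q → Dec (Edge P Q)
  edge? P Q = Any.any? (λ L → Sel? L ×-dec (P on? L) ×-dec (Q on? L) ×-dec ¬? (colour L P Fin.≟ colour L Q)) lines

  edge-sym : ∀ {P Q} → Edge P Q → Edge Q P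
  edge-sym = Any.map λ (sel , PL , QL , ne) → sel , QL , PL , ne ∘ sym

  graphOn : ∀ vs → Unique vs → (∀ {P} → P ∈ vs → P ∉ deleted) → 4 ≤ s →
            Σ (Graph (length vs)) λ G → KFree G (s + 2) × (∀ W → KFreeOn G s W → ∣ W ∣ ≤ w)
  graphOn vs u kept 4≤s = G , free , λ W noClique → ≮⇒≥ (noClique ∘ large W)
    where
    pt : Fin (length vs) → Point
    pt = List.lookup vs
    G : Graph (length vs)
    G = record
      { adj = λ x y → does (edge? (pt x) (pt y))
      ; sym = λ x y → does-cong (edge? (pt x) (pt y)) (edge? (pt y) (pt x)) edge-sym edge-sym
      ; irrefl = λ x → dec-false (edge? (pt x) (pt x)) λ e →
          let _ , _ , _ , _ , ne = Any.satisfied e in ne refl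
      }
    free : KFree G (s + 2)
    free W (f , _ , clique) = refute (clique⇒config 4≤s Sel colour (pt ∘ f ∘ toF) adjacent)
      where
      toF : Fin (2 + s) → Fin (s + 2)
      toF = Fin.cast (+-comm 2 s)
      refute : ¬ ∃ λ γ → γ ∈ configs × Unique (proj₂ γ) × All Sel (proj₂ γ) × ∃ λ i → pt (f (toF i)) ≡ proj₁ γ
      refute (γ , γ∈ , uγ , selγ , i , e) =
        kept (subst (_∈ vs) e (∈ₚ.∈-lookup (f (toF i)))) (deleted∋ γ∈ (uγ , selγ))
      adjacent : ∀ {i j} → i ≢ j → pt (f (toF i)) ≢ pt (f (toF j)) ×
        ∃ λ L → Sel L × pt (f (toF i)) on L × pt (f (toF j)) on L × colour L (pt (f (toF i))) ≢ colour L (pt (f (toF j)))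
      adjacent {i} {j} i≢j =
        let ne , ad = clique (toF i) (toF j) (i≢j ∘ Finₚ.toℕ-injective ∘ λ e →
                        trans (sym (Finₚ.toℕ-cast (+-comm 2 s) i)) (trans (cong toℕ e) (Finₚ.toℕ-cast (+-comm 2 s) j)))
        in ne ∘ lookup-injective u , Any.satisfied (fromDoes (edge? (pt (f (toF i))) (pt (f (toF j)))) ad)
    large : ∀ W → w < ∣ W ∣ → CliqueIn G s W
    large W w<W = g , g∈W , adjacent
      where
      T = take w (elements W)
      rainbow = tuple-rainbow (map pt T) (Uniqueₚ.map⁺ (lookup-injective u) (Uniqueₚ.take⁺ w (elements-unique W)))
        (trans (Listₚ.length-map pt T) (trans (Listₚ.length-take w (elements W))
          (m≤n⇒m⊓n≡m (subst (w ≤_) (sym (length-elements W)) (<⇒≤ w<W)))))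
      L = proj₁ rainbow
      sel = proj₁ (proj₂ rainbow)
      v = proj₁ (proj₂ (proj₂ rainbow))
      spec = proj₂ (proj₂ (proj₂ rainbow))
      g : Fin s → Fin (length vs)
      g j = proj₁ (∈ₚ.∈-map⁻ pt (proj₁ (spec j)))
      vg : ∀ j → v j ≡ pt (g j)
      vg j = proj₂ (proj₂ (∈ₚ.∈-map⁻ pt (proj₁ (spec j))))
      take⊆ : ∀ n (xs : List (Fin (length vs))) {x} → x ∈ take n xs → x ∈ xs
      take⊆ (suc n) (_ ∷ _)  (here e)   = here e
      take⊆ (suc n) (_ ∷ xs) (there x∈) = there (take⊆ n xs x∈)
      g∈W : ∀ j → g j Subset.∈ W
      g∈W j = elements⊆ W (take⊆ w (elements W) (proj₁ (proj₂ (∈ₚ.∈-map⁻ pt (proj₁ (spec j))))))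
      colour≡ : ∀ j → colour L (pt (g j)) ≡ j
      colour≡ j = trans (cong (colour L) (sym (vg j))) (proj₂ (proj₂ (spec j)))
      g-on : ∀ j → pt (g j) on L
      g-on j = subst (_on L) (vg j) (proj₁ (proj₂ (spec j)))
      colours≢ : ∀ {i j} → i ≢ j → colour L (pt (g i)) ≢ colour L (pt (g j))
      colours≢ i≢j e = i≢j (trans (sym (colour≡ _)) (trans e (colour≡ _)))
      adjacent : ∀ i j → i ≢ j → (g i ≢ g j) × (adj G (g i) (g j) ≡ true)
      adjacent i j i≢j = (λ e → colours≢ i≢j (cong (colour L ∘ pt) e)) ,
        dec-true (edge? (pt (g i)) (pt (g j))) (Any.map (λ { refl → (sel , g-on i , g-on j , colours≢ i≢j) }) (allLines L))

  graph : ∀ n → 2 * n ≤ q * q → 4 ≤ s →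
          Σ (Graph n) λ G → KFree G (s + 2) × (∀ W → KFreeOn G s W → ∣ W ∣ ≤ w)
  graph n 2n≤ 4≤s =
    let vs , len , u , kept = greedy _≟ᴾ_ uniquePoints deleted n enough
    in subst (λ n → Σ (Graph n) λ G → KFree G (s + 2) × (∀ W → KFreeOn G s W → ∣ W ∣ ≤ w)) len (graphOn vs u kept 4≤s)
    where
    open ≤-Reasoning
    enough : n + length deleted ≤ length points
    enough = *-cancelˡ-≤ 2 (begin
      2 * (n + length deleted)      ≡⟨ *-distribˡ-+ 2 n _ ⟩
      2 * n + 2 * length deleted    ≤⟨ +-mono-≤ 2n≤ (≤-trans (*-monoʳ-≤ 2 #deleted) fewBad) ⟩
      q * q + q * q                 ≡⟨ cong (q * q +_) (+-identityʳ (q * q)) ⟨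
      2 * (q * q)                   ≡⟨ cong (2 *_) #points ⟨
      2 * length points             ∎)

-- Choice of the parameters

-- h is q/2 rounded down; q = 3 is the extreme case of the second bound.
half : ∀ q → 2 ≤ q → ∃ λ h → 2 * h ≤ q × q ≤ 3 * h
half 2 _ = 1 , ≤-refl , n≤1+n 2
half 3 _ = 1 , n≤1+n 2 , ≤-refl
half (suc (suc q@(suc (suc _)))) _ with half q (s≤s (s≤s z≤n))
... | h , 2h≤q , q≤3h = suc h ,
      ≤-trans (≤-reflexive (*-suc 2 h)) (s≤s (s≤s 2h≤q)) ,
      ≤-trans (s≤s (s≤s q≤3h)) (≤-trans (n≤1+n _) (≤-reflexive (sym (*-suc 3 h))))
half 1 (s≤s ())

n<2^n : ∀ n → n < 2 ^ n
n<2^n zero    = s≤s z≤n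
n<2^n (suc n) = begin-strict
  suc n           <⟨ s≤s (n<2^n n) ⟩
  1 + 2 ^ n       ≤⟨ +-monoˡ-≤ (2 ^ n) (m^n>0 2 n) ⟩
  2 ^ n + 2 ^ n   ≡⟨ cong (2 ^ n +_) (+-identityʳ (2 ^ n)) ⟨
  2 ^ suc n       ∎
  where open ≤-Reasoning

power-between : ∀ a → 2 ≤ a → ∀ n → 1 ≤ n → ∃ λ e → n ≤ a ^ e × a ^ e ≤ a * n
power-between a 2≤a 1 _ = 0 , ≤-refl , ≤-trans (<⇒≤ 2≤a) (≤-reflexive (sym (*-identityʳ a)))
power-between a 2≤a (suc n@(suc _)) _ with power-between a 2≤a n (s≤s z≤n)
... | e , n≤ , ≤an with suc n ≤? a ^ e
...   | yes le = e , le , ≤-trans ≤an (*-monoʳ-≤ a (n≤1+n n))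
...   | no ¬le = suc e , bound , *-monoʳ-≤ a (<⇒≤ (≰⇒> ¬le))
  where
  open ≤-Reasoning
  bound : suc n ≤ a * a ^ e
  bound = begin
    1 + n         ≤⟨ +-monoˡ-≤ n (s≤s z≤n) ⟩
    n + n         ≡⟨ cong (n +_) (+-identityʳ n) ⟨
    2 * n         ≤⟨ *-mono-≤ 2≤a n≤ ⟩
    a * a ^ e     ∎

Witness : ℕ → ℕ → (ℕ → Set) → Set
Witness s n P = Σ (Graph n) λ G → KFree G (s + 2) × (∀ W → KFreeOn G s W → P ∣ W ∣)

mapWitness : ∀ {s n P Q} → (∀ {m} → P m → Q m) → Witness s n P → Witness s n Q
mapWitness f (G , free , small) = G , free , λ W noClique → f (small W noClique)

graphs : ∀ s q k → 4 ≤ s → Prime q → k * s ^ s ≤ q → ∀ h → 2 * h ≤ q →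
         (q * q) ^ tupleSize s q * (q * q) ≤ 2 ^ (k * h) → 2 * badBound q (k * s ^ s) ≤ q * q →
         ∀ n → 2 * n ≤ q * q →
         Witness s n (_≤ tupleSize s q)
graphs s q k 4≤s pq b≤q h 2h≤q union few n 2n≤ =
  Construction.graph s q k {{>-nonZero (≤-trans (s≤s z≤n) 4≤s)}} {{q≢0}} (affinePlane pq) b≤q (x , x) (x , x)
    h 2h≤q union few n 2n≤ 4≤s
  where
  q≢0 = prime⇒nonZero pq
  x = Fin.fromℕ< (>-nonZero⁻¹ q {{q≢0}})

slope : ℕ → ℕ
slope s = 2 * (1 + 2 * s)

abstract
  -- The ratio of k to ℓ, where q ≤ 2^ℓ. With C = `slope s` the union bound needs 2ℓ(1 + Cq) ≤ k h,
  -- and 1 ≤ h, q ≤ 3h bound the left side by (6C + 2) ℓ h.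
  density : ℕ → ℕ
  density s = 6 * slope s + 2

  density≡ : ∀ s → density s ≡ 6 * slope s + 2
  density≡ s = refl

unionBound : ∀ s q ℓ h → q ≤ 2 ^ ℓ → q ≤ 3 * h → 1 ≤ h →
             (q * q) ^ tupleSize s q * (q * q) ≤ 2 ^ (density s * ℓ * h)
unionBound s q ℓ h q≤ q≤3h 1≤h = begin
  (q * q) ^ w * (q * q)       ≡⟨ *-comm ((q * q) ^ w) (q * q) ⟩
  (q * q) ^ suc w             ≤⟨ ^-monoˡ-≤ (suc w) (*-mono-≤ q≤ q≤) ⟩
  (2 ^ ℓ * 2 ^ ℓ) ^ suc w     ≡⟨ cong (_^ suc w) (^-distribˡ-+-* 2 ℓ ℓ) ⟨
  (2 ^ (ℓ + ℓ)) ^ suc w       ≡⟨ ^-*-assoc 2 (ℓ + ℓ) (suc w) ⟩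
  2 ^ ((ℓ + ℓ) * suc w)       ≤⟨ ^-monoʳ-≤ 2 exponent ⟩
  2 ^ (density s * ℓ * h)     ∎
  where
  open ≤-Reasoning
  w = tupleSize s q
  C = slope s
  lemma₁ : ∀ ℓ w → (ℓ + ℓ) * suc w ≡ ℓ * (2 * (1 + w))
  lemma₁ = solve-∀
  lemma₂ : ∀ C ℓ h → ℓ * (2 * (h + C * (3 * h))) ≡ (6 * C + 2) * ℓ * h
  lemma₂ = solve-∀
  exponent : (ℓ + ℓ) * suc w ≤ density s * ℓ * h
  exponent = begin
    (ℓ + ℓ) * suc w               ≡⟨ lemma₁ ℓ w ⟩
    ℓ * (2 * (1 + C * q))         ≤⟨ *-monoʳ-≤ ℓ (*-monoʳ-≤ 2 (+-mono-≤ 1≤h (*-monoʳ-≤ C q≤3h))) ⟩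
    ℓ * (2 * (h + C * (3 * h)))   ≡⟨ lemma₂ C ℓ h ⟩
    (6 * C + 2) * ℓ * h           ≡⟨ cong (λ d → d * ℓ * h) (density≡ s) ⟨
    density s * ℓ * h             ∎

-- Each of the four terms of `badBound` is at most q b^9, which with the factor 2 gives the 8.
fewBad : ∀ q b .{{_ : NonZero q}} .{{_ : NonZero b}} → 8 * b ^ 9 ≤ q → 2 * badBound q b ≤ q * q
fewBad q b h = begin
  2 * (1 + q * (b ^ 9 + b ^ 8 + b ^ 7)) ≤⟨ *-monoʳ-≤ 2 (+-mono-≤ (>-nonZero⁻¹ (q * y) {{m*n≢0 q y {{it}} {{m^n≢0 b 9}}}})
      (*-monoʳ-≤ q (+-mono-≤ (+-monoʳ-≤ y (^-monoʳ-≤ b (m≤m+n 8 1))) (^-monoʳ-≤ b (m≤m+n 7 2))))) ⟩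
  2 * (q * y + q * (y + y + y))         ≡⟨ lemma q y ⟩
  q * (8 * y)                           ≤⟨ *-monoʳ-≤ q h ⟩
  q * q                                 ∎
  where
  open ≤-Reasoning
  y = b ^ 9
  it : NonZero q
  it = >-nonZero (>-nonZero⁻¹ q)
  lemma : ∀ q y → 2 * (q * y + q * (y + y + y)) ≡ q * (8 * y)
  lemma = solve-∀

-- The expected number b of selected lines through a point is width s * t, for q about 2 ^ (20 t).
width : ℕ → ℕ
width s = 20 * (density s * s ^ s)

-- 64 is the 8 of `fewBad` times the factor 8 by which q may fall short of 2^(20 t).
threshold : ℕ → ℕ
threshold s = 64 * width s ^ 9

-- A power of log q against q: one further factor t absorbs 64 a^9, and t^10 ≤ 2^(10 t).
logarithmic : ∀ a t → 64 * a ^ 9 ≤ t → 64 * (a * t) ^ 9 ≤ 2 ^ (10 * t + 10 * t)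
logarithmic a t h = begin
  64 * (a * t) ^ 9          ≡⟨ cong (64 *_) (^-distribʳ-* a t 9) ⟩
  64 * (a ^ 9 * t ^ 9)      ≡⟨ *-assoc 64 (a ^ 9) (t ^ 9) ⟨
  64 * a ^ 9 * t ^ 9        ≤⟨ *-monoˡ-≤ (t ^ 9) h ⟩
  t ^ 10                    ≤⟨ ^-monoˡ-≤ 10 (<⇒≤ (n<2^n t)) ⟩
  (2 ^ t) ^ 10              ≡⟨ ^-*-assoc 2 t 10 ⟩
  2 ^ (t * 10)              ≡⟨ cong (2 ^_) (*-comm t 10) ⟩
  2 ^ (10 * t)              ≤⟨ ^-monoʳ-≤ 2 (m≤m+n (10 * t) (10 * t)) ⟩
  2 ^ (10 * t + 10 * t)     ∎
  where open ≤-Reasoning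

abstract
  -- With q about 2^(20 t), the plane has about Λ^t points.
  Λ : ℕ
  Λ = 2 ^ 40

  Λ≡ : Λ ≡ 2 ^ 40
  Λ≡ = refl

  128≤Λ : 128 ≤ Λ
  128≤Λ = ≤ᵇ⇒≤ 128 Λ tt

instance
  Λ≢0 : NonZero Λ
  Λ≢0 = >-nonZero (≤-trans (s≤s z≤n) 128≤Λ)

graphs-from-prime : ∀ s t q h → 4 ≤ s → 1 ≤ t → threshold s ≤ t → Prime q →
  2 ^ (10 * t + 10 * t ∸ 3) < q → q ≤ 2 ^ (10 * t + 10 * t) → 2 * h ≤ q → q ≤ 3 * h → ∀ n → 128 * n ≤ Λ ^ t →
  Witness s n (λ m → m * m ≤ slope s * slope s * Λ ^ t)
graphs-from-prime s t q h 4≤s 1≤t thr pq lower upper 2h≤q q≤3h n 128n≤ =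
  mapWitness {P = _≤ tupleSize s q} (λ {m} m≤ → begin
    m * m                    ≤⟨ *-mono-≤ m≤ m≤ ⟩
    C * q * (C * q)          ≤⟨ *-mono-≤ (*-monoʳ-≤ C upper) (*-monoʳ-≤ C upper) ⟩
    C * N * (C * N)          ≡⟨ lemma₁ C N ⟩
    C * C * (N * N)          ≡⟨ cong (C * C *_) N² ⟩
    C * C * Λ ^ t            ∎)
    (graphs s q k 4≤s pq b≤q h 2h≤q (unionBound s q ℓ h upper q≤3h 1≤h)
      (fewBad q b {{prime⇒nonZero pq}} {{b≢0}} 8b⁹≤q) n 2n≤)
  where
  open ≤-Reasoning
  C = slope s
  ℓ = 10 * t + 10 * t
  N = 2 ^ ℓ
  k = density s * ℓ
  b = k * s ^ s
  lemma₁ : ∀ C N → C * N * (C * N) ≡ C * C * (N * N)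
  lemma₁ = solve-∀
  N² : N * N ≡ Λ ^ t
  N² = trans (sym (^-distribˡ-+-* 2 ℓ ℓ)) (trans (cong (2 ^_) (lemma t)) (trans (sym (^-*-assoc 2 40 t)) (cong (_^ t) (sym Λ≡))))
    where
    lemma : ∀ t → 10 * t + 10 * t + (10 * t + 10 * t) ≡ 40 * t
    lemma = solve-∀
  b≡ : b ≡ width s * t
  b≡ = lemma (density s) t (s ^ s)
    where
    lemma : ∀ d t x → d * (10 * t + 10 * t) * x ≡ 20 * (d * x) * t
    lemma = solve-∀
  b≢0 : NonZero b
  b≢0 = subst NonZero (sym b≡) (m*n≢0 (width s) t {{width≢0}} {{>-nonZero 1≤t}})
    where
    density≢0 : NonZero (density s)
    density≢0 = subst NonZero (sym (density≡ s)) (>-nonZero (≤-trans (s≤s z≤n) (m≤n+m 2 (6 * C))))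
    width≢0 : NonZero (width s)
    width≢0 = m*n≢0 20 (density s * s ^ s) {{_}} {{m*n≢0 (density s) (s ^ s) {{density≢0}}
                {{m^n≢0 s s {{>-nonZero (≤-trans (s≤s z≤n) 4≤s)}}}}}}
  N<8q : N < 8 * q
  N<8q = begin-strict
    N                             ≡⟨ cong (2 ^_) (m+[n∸m]≡n (≤-trans (≤-trans (m≤m+n 3 7) (*-monoʳ-≤ 10 1≤t)) (m≤m+n (10 * t) (10 * t)))) ⟨
    2 ^ (3 + (ℓ ∸ 3))             ≡⟨ ^-distribˡ-+-* 2 3 (ℓ ∸ 3) ⟩
    8 * 2 ^ (ℓ ∸ 3)               <⟨ *-monoʳ-< 8 lower ⟩
    8 * q                         ∎
  8b⁹≤q : 8 * b ^ 9 ≤ q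
  8b⁹≤q = *-cancelˡ-≤ 8 (begin
    8 * (8 * b ^ 9)     ≡⟨ *-assoc 8 8 (b ^ 9) ⟨
    64 * b ^ 9          ≡⟨ cong (λ b → 64 * b ^ 9) b≡ ⟩
    64 * (width s * t) ^ 9 ≤⟨ logarithmic (width s) t thr ⟩
    N                   ≤⟨ <⇒≤ N<8q ⟩
    8 * q               ∎)
  b≤q : b ≤ q
  b≤q = begin
    b           ≡⟨ *-identityʳ b ⟨
    b ^ 1       ≤⟨ ^-monoʳ-≤ b {{b≢0}} (m≤m+n 1 8) ⟩
    b ^ 9       ≤⟨ m≤n*m (b ^ 9) 8 ⟩
    8 * b ^ 9   ≤⟨ 8b⁹≤q ⟩
    q           ∎
  1≤h : 1 ≤ h
  1≤h = positive h q≤3h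
    where
    positive : ∀ h → q ≤ 3 * h → 1 ≤ h
    positive zero    q≤0 = contradiction (≤-trans (nonTrivial⇒n>1 q {{prime⇒nonTrivial pq}}) q≤0) λ ()
    positive (suc h) _   = s≤s z≤n
  2n≤ : 2 * n ≤ q * q
  -- Λ^t is at most 64 q² since q is short by a factor below 8; 128 is 64 times the 2 allowing for
  -- deletions.
  2n≤ = *-cancelˡ-≤ 64 (begin
    64 * (2 * n)        ≡⟨ *-assoc 64 2 n ⟨
    128 * n             ≤⟨ 128n≤ ⟩
    Λ ^ t               ≡⟨ N² ⟨
    N * N               ≤⟨ *-mono-≤ (<⇒≤ N<8q) (<⇒≤ N<8q) ⟩
    8 * q * (8 * q)     ≡⟨ lemma q ⟩
    64 * (q * q)        ∎)
    where
    lemma : ∀ q → 8 * q * (8 * q) ≡ 64 * (q * q)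
    lemma = solve-∀

graphs-at-scale : ∀ s t → 4 ≤ s → 1 ≤ t → threshold s ≤ t → ∀ n → 128 * n ≤ Λ ^ t →
  Witness s n (λ m → m * m ≤ slope s * slope s * Λ ^ t)
graphs-at-scale s t 4≤s 1≤t thr n 128n≤ =
  let q , pq , lower , upper = chebyshev (10 * t) (10 * t + 10 * t ∸ 3) (≤-trans (m≤m+n 8 2) (*-monoʳ-≤ 10 1≤t))
        (m+[n∸m]≡n (≤-trans (≤-trans (m≤m+n 3 7) (*-monoʳ-≤ 10 1≤t)) (m≤m+n (10 * t) (10 * t))))
      h , 2h≤q , q≤3h = half q (nonTrivial⇒n>1 q {{prime⇒nonTrivial pq}})
  in graphs-from-prime s t q h 4≤s 1≤t thr pq lower upper 2h≤q q≤3h n 128n≤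

theorem2 : ∀ (s : ℕ) → 4 ≤ s →
    Σ ℕ λ c → NonZero c ×
    (∀ (n : ℕ) → 1 ≤ n →
    Σ (Graph n) λ G → KFree G (s + 2) ×
    (∀ (W : Subset n) → KFreeOn G s W → ∣ W ∣ * ∣ W ∣ ≤ c * n))
theorem2 s 4≤s = c , c≢0 , construct
  where
  open ≤-Reasoning
  t₀ = suc (threshold s)
  C = slope s
  -- `Λ ^ t₀` shifts the exponent past the threshold, also for small n, and the last `Λ` pays for
  -- rounding n up to a power of `Λ`.
  c = C * C * (Λ ^ t₀ * Λ)
  c≢0 : NonZero c
  c≢0 = m*n≢0 (C * C) (Λ ^ t₀ * Λ) {{m*n≢0 C C}} {{m*n≢0 (Λ ^ t₀) Λ {{m^n≢0 Λ t₀}}}}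
  construct : ∀ n → 1 ≤ n → Σ (Graph n) λ G → KFree G (s + 2) ×
              (∀ W → KFreeOn G s W → ∣ W ∣ * ∣ W ∣ ≤ c * n)
  construct n 1≤n with power-between Λ (≤-trans (m≤m+n 2 126) 128≤Λ) n 1≤n
  ... | e , n≤Λᵉ , Λᵉ≤Λn =
    mapWitness {P = λ m → m * m ≤ C * C * Λ ^ (t₀ + e)} (λ {m} m²≤ → begin
      m * m                       ≤⟨ m²≤ ⟩
      C * C * Λ ^ (t₀ + e)        ≡⟨ cong (C * C *_) (^-distribˡ-+-* Λ t₀ e) ⟩
      C * C * (Λ ^ t₀ * Λ ^ e)    ≤⟨ *-monoʳ-≤ (C * C) (*-monoʳ-≤ (Λ ^ t₀) Λᵉ≤Λn) ⟩
      C * C * (Λ ^ t₀ * (Λ * n))  ≡⟨ lemma (C * C) (Λ ^ t₀) Λ n ⟩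
      c * n                       ∎)
      (graphs-at-scale s (t₀ + e) 4≤s (s≤s z≤n) (≤-trans (n≤1+n _) (m≤m+n t₀ e)) n large)
    where
    lemma : ∀ a x y n → a * (x * (y * n)) ≡ a * (x * y) * n
    lemma = solve-∀
    large : 128 * n ≤ Λ ^ (t₀ + e)
    large = begin
      128 * n             ≤⟨ *-mono-≤ {128} {Λ ^ t₀} (≤-trans 128≤Λ (m≤m*n Λ (Λ ^ threshold s) {{m^n≢0 Λ (threshold s)}})) n≤Λᵉ ⟩
      Λ ^ t₀ * Λ ^ e      ≡⟨ ^-distribˡ-+-* Λ t₀ e ⟨
      Λ ^ (t₀ + e)        ∎
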